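{- For every prime $p\geq 7$, $$\sum_{k=0}^{p-1}(2k+1)A_k\equiv p-\frac{7}{2}p^2H_{p-1}\pmod{p^6},$$ where $A_k=\sum_{j=0}^{k}\binom{k+j}{j}^2\binom{k}{j}^2$ is the $k$-th Apéry number and $H_{p-1}=\sum_{j=1}^{p-1}\frac1j$.
   Context: Congruences between rational numbers modulo a power of $p$ are understood in the ring of rationals whose denominators are prime to $p$. -}

module Defs where

open import Data.Nat as ℕ using (ℕ; zero; suc)
open import Data.Nat.Combinatorics using (_C_)
open import Data.Nat.Coprimality using (Coprime)
open import Data.Rational as ℚ using (ℚ; _-_; _*_; _+_; _/_; ↧ₙ_)
open import Data.Integer as ℤ using (+_)
open import Data.Product using (Σ; _×_)
open import Relation.Binary.PropositionalEquality using (_≡_)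

sumℕ : ℕ → (ℕ → ℕ) → ℕ
sumℕ zero    f = 0
sumℕ (suc n) f = sumℕ n f ℕ.+ f n

sumℚ : ℕ → (ℕ → ℚ) → ℚ
sumℚ zero    f = ℚ.0ℚ
sumℚ (suc n) f = sumℚ n f + f n

apery : ℕ → ℕ
apery k = sumℕ (suc k) (λ j → ((k ℕ.+ j) C j) ℕ.^ 2 ℕ.* (k C j) ℕ.^ 2)

harmonic : ℕ → ℚ
harmonic n = sumℚ n (λ i → (+ 1) / suc i)

ι : ℕ → ℚ
ι n = + n / 1

-- a ≡ b (mod m) in the ring of rationals whose denominators are prime to p:
-- a - b = m * x with x ∈ ℚ having (reduced) denominator coprime to p
CongQ : (p : ℕ) → ℚ → ℚ → ℚ → Set
CongQ p a b m = Σ ℚ (λ x → Coprime (↧ₙ x) p × (a - b ≡ m * x))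

{-# OPTIONS --safe #-}
module Submission where

-- Write p = 2m + 1 and B(k,j) = C(k+j,j) C(k,j).  The numbers W(n,j) = (n - j) B(n,j) satisfy
-- W(k+1,j)² = W(k,j)² + (2j+1)(2k+1) B(k,j)², so the sum telescopes to
--   S = p² Σ_{j<p} (1/(2j+1)) Π_{1≤i≤j} (1 - p²/i²)².
-- Modulo p⁶ this leaves S ≡ p² (O - 2p² X), where O = Σ_{j<p} 1/(2j+1) and
-- X = Σ_{j<p} (1/(2j+1)) Σ_{1≤i≤j} 1/i²; the two sums contain 1/p through j = m.
-- Let Q = Σ_{1≤i≤m} 1/(i(p-i)), so that H_{p-1} = pQ.  The reflections i ↦ p - i and i ↦ 3p - i
-- give O ≡ 1/p + (7/2) pQ (mod p⁴).  For X, Abel summation and the exact identity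
--   Σ_{1≤i<n} O_i / (i(n-i)) = (1/n) (F_{2n-1} - F_{n-1}/4),
-- with O_i = Σ_{j<i} 1/(2j+1) and F_N = H_N² - H_N⁽²⁾, reduce the double sum to single ones and
-- yield p² X ≡ (7/2) pQ (mod p⁴).

open import Defs using (sumℕ; apery)
open import Algebra.Bundles using (CommutativeRing; RawRing)
import Algebra.Solver.Ring as RingSolver
open import Algebra.Solver.Ring.AlmostCommutativeRing
  using (fromCommutativeRing; _-Raw-AlmostCommutative⟶_)
open import Algebra.Structures using (IsCommutativeRing)
open import Data.Integer as ℤ using (ℤ; +_; -[1+_])
import Data.Integer.Properties as ℤ
open import Data.Maybe using (Maybe; just; nothing)
open import Data.Nat as ℕ using (ℕ; zero; suc; z≤n; s≤s)
open import Data.Nat.Combinatorics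
  using (_C_; nCk≡nC[n∸k]; nCn≡1; k>n⇒nCk≡0; nCk+nC[k+1]≡[n+1]C[k+1])
open import Data.Nat.Coprimality using (Coprime; coprime-divisor)
open import Data.Nat.Divisibility using (_∣_; divides; >⇒∤; ∣m+n∣m⇒∣n; ∣-refl; ∣-trans; ∣⇒≤)
import Data.Nat.Properties as ℕ
open import Data.Nat.Tactic.RingSolver using (solve-∀)
open import Data.Product using (∃; _×_; _,_)
open import Data.Sum using (_⊎_; inj₁; inj₂)
open import Function using (_∘_)
open import Level using (0ℓ)
open import Relation.Binary.Definitions using (tri<; tri≈; tri>)
open import Relation.Binary.PropositionalEquality
  using (_≡_; refl; sym; trans; cong; cong₂; subst; module ≡-Reasoning)
open import Relation.Nullary using (¬_; yes; no; contradiction)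

-- The obstacle is precision at j = m, where 1/(2j+1) is 1/p. A congruence therefore means that a
-- difference is p^k times a p-integral element, while the two sides may have p in the denominator;
-- and dropping the p⁴ term of the product at j = m requires its coefficient to vanish modulo p.
--
-- Write h_k and H_k for the sums of 1/i^k over 1 ≤ i ≤ m and 1 ≤ i < p. The inputs are h₄ ≡ 0 (mod
-- p), and 7H₂ ≡ 2h₂ and H₂ ≡ -2Q (mod p³). The first two come from splitting a sum over 1 ≤ i < p
-- both by reflection and by parity. For h₄ this leaves the factor 16 - 1 = 15, which is why 3 and 5
-- are excluded. Together they give h₂ ≡ -7Q. The constant 7/2 arises once as 1 + 3 - 1/2 in O, from
-- H_{2p-1} - H_{p-1}/2, and once as -2 - 6 + 23/2 in p² X; then 7/2 - 2 · 7/2 = -7/2.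
--
-- The argument runs in an abstract ring with a subring of p-integral elements, so no step depends
-- on reduced fractions; ℚ enters only at the end.

-- The clause for 1 makes it 1# itself, so that the solver's constant 1 is definitionally 1#.
multiple : {A : Set} → (A → A → A) → A → A → ℕ → A
multiple _+_ 0# 1# zero          = 0#
multiple _+_ 0# 1# (suc zero)    = 1#
multiple _+_ 0# 1# (suc (suc n)) = 1# + multiple _+_ 0# 1# (suc n)

-- Nothing is assumed about inv 0.
record RationalAlgebra : Set₁ where
  infixl 6 _+_
  infixl 7 _*_
  infix  8 -_
  field
    Carrier : Set
    _+_ _*_ : Carrier → Carrier → Carrier
    -_      : Carrier → Carrier
    0# 1#   : Carrier
    isCommutativeRing : IsCommutativeRing _≡_ _+_ _*_ -_ 0# 1#

  infixl 6 _-_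
  _-_ : Carrier → Carrier → Carrier
  x - y = x + (- y)

  ι : ℕ → Carrier
  ι n = multiple _+_ 0# 1# n

  field
    inv   : ℕ → Carrier
    ι-inv : ∀ n → ι (suc n) * inv (suc n) ≡ 1#

  commutativeRing : CommutativeRing 0ℓ 0ℓ
  commutativeRing = record { isCommutativeRing = isCommutativeRing }

-- Integers in the ring, the ring solver, finite sums and reciprocals

module Base (𝓡 : RationalAlgebra) where
  open RationalAlgebra 𝓡 public
  private module CR = CommutativeRing commutativeRing
  open CR using (+-assoc; +-comm; +-identityˡ; +-identityʳ; *-identityˡ; distribʳ; zeroˡ;
    -‿inverseʳ; *-comm; *-assoc)
  open import Algebra.Properties.Ring CR.ring using (-‿distribˡ-*; -‿distribʳ-*; -0#≈0#)
  open import Algebra.Properties.AbelianGroup CR.+-abelianGroup using (⁻¹-∙-comm; ⁻¹-involutive)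
  open import Algebra.Properties.Semiring.Exp CR.semiring public using (_^_; ^-homo-*)

  ι-suc : ∀ n → ι (suc n) ≡ 1# + ι n
  ι-suc zero    = sym (+-identityʳ 1#)
  ι-suc (suc n) = refl

  ι-+ : ∀ m n → ι (m ℕ.+ n) ≡ ι m + ι n
  ι-+ zero    n = sym (+-identityˡ (ι n))
  ι-+ (suc m) n = begin
    ι (suc (m ℕ.+ n))     ≡⟨ ι-suc (m ℕ.+ n) ⟩
    1# + ι (m ℕ.+ n)      ≡⟨ cong (_+_ 1#) (ι-+ m n) ⟩
    1# + (ι m + ι n)      ≡⟨ sym (+-assoc 1# (ι m) (ι n)) ⟩
    1# + ι m + ι n        ≡⟨ cong (_+ ι n) (sym (ι-suc m)) ⟩
    ι (suc m) + ι n       ∎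
    where open ≡-Reasoning

  ι-* : ∀ m n → ι (m ℕ.* n) ≡ ι m * ι n
  ι-* zero    n = sym (zeroˡ (ι n))
  ι-* (suc m) n = begin
    ι (n ℕ.+ m ℕ.* n)       ≡⟨ ι-+ n (m ℕ.* n) ⟩
    ι n + ι (m ℕ.* n)       ≡⟨ cong₂ _+_ (sym (*-identityˡ (ι n))) (ι-* m n) ⟩
    1# * ι n + ι m * ι n    ≡⟨ sym (distribʳ (ι n) 1# (ι m)) ⟩
    (1# + ι m) * ι n        ≡⟨ cong (_* ι n) (sym (ι-suc m)) ⟩
    ι (suc m) * ι n         ∎
    where open ≡-Reasoning

  ι-^ : ∀ n k → ι (n ℕ.^ k) ≡ ι n ^ k
  ι-^ n zero    = refl
  ι-^ n (suc k) = trans (ι-* n (n ℕ.^ k)) (cong (_*_ (ι n)) (ι-^ n k))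

  ι-∸ : ∀ {m n} → n ℕ.≤ m → ι (m ℕ.∸ n) ≡ ι m - ι n
  ι-∸ {m} {n} n≤m = begin
    ι (m ℕ.∸ n)                     ≡⟨ sym (+-identityʳ _) ⟩
    ι (m ℕ.∸ n) + 0#                ≡⟨ cong (_+_ _) (sym (-‿inverseʳ (ι n))) ⟩
    ι (m ℕ.∸ n) + (ι n - ι n)       ≡⟨ sym (+-assoc _ _ _) ⟩
    ι (m ℕ.∸ n) + ι n - ι n         ≡⟨ cong (_- ι n) (sym (ι-+ (m ℕ.∸ n) n)) ⟩
    ι (m ℕ.∸ n ℕ.+ n) - ι n         ≡⟨ cong (λ z → ι z - ι n) (ℕ.m∸n+n≡m n≤m) ⟩
    ι m - ι n                       ∎
    where open ≡-Reasoning

  ⟦_⟧ℤ : ℤ → Carrier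
  ⟦ + n ⟧ℤ      = ι n
  ⟦ -[1+ n ] ⟧ℤ = - ι (suc n)

  private
    neg-minus : ∀ x y → - (x - y) ≡ y - x
    neg-minus x y = begin
      - (x - y)      ≡⟨ sym (⁻¹-∙-comm x (- y)) ⟩
      - x + - (- y)  ≡⟨ cong (_+_ (- x)) (⁻¹-involutive y) ⟩
      - x + y        ≡⟨ +-comm (- x) y ⟩
      y - x          ∎
      where open ≡-Reasoning

    ⟦-⟧ : ∀ i → ⟦ ℤ.- i ⟧ℤ ≡ - ⟦ i ⟧ℤ
    ⟦-⟧ (+ zero)   = sym -0#≈0#
    ⟦-⟧ (+ suc n)  = refl
    ⟦-⟧ (-[1+ n ]) = sym (⁻¹-involutive _)

    ⟦⊖⟧ : ∀ m n → ⟦ m ℤ.⊖ n ⟧ℤ ≡ ι m - ι n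
    ⟦⊖⟧ m n with ℕ.≤-total n m
    ... | inj₁ n≤m = trans (cong ⟦_⟧ℤ (ℤ.⊖-≥ n≤m)) (ι-∸ n≤m)
    ... | inj₂ m≤n = begin
      ⟦ m ℤ.⊖ n ⟧ℤ            ≡⟨ cong ⟦_⟧ℤ (ℤ.⊖-≤ m≤n) ⟩
      ⟦ ℤ.- + (n ℕ.∸ m) ⟧ℤ    ≡⟨ ⟦-⟧ (+ (n ℕ.∸ m)) ⟩
      - ι (n ℕ.∸ m)           ≡⟨ cong -_ (ι-∸ m≤n) ⟩
      - (ι n - ι m)           ≡⟨ neg-minus (ι n) (ι m) ⟩
      ι m - ι n               ∎
      where open ≡-Reasoning

    ⟦+⟧ : ∀ i j → ⟦ i ℤ.+ j ⟧ℤ ≡ ⟦ i ⟧ℤ + ⟦ j ⟧ℤ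
    ⟦+⟧ (+ m)      (+ n)      = ι-+ m n
    ⟦+⟧ (+ m)      (-[1+ n ]) = ⟦⊖⟧ m (suc n)
    ⟦+⟧ (-[1+ m ]) (+ n)      = trans (⟦⊖⟧ n (suc m)) (+-comm _ _)
    ⟦+⟧ (-[1+ m ]) (-[1+ n ]) = begin
      - ι (suc (suc (m ℕ.+ n)))    ≡⟨ cong (λ z → - ι z) (sym (ℕ.+-suc (suc m) n)) ⟩
      - ι (suc m ℕ.+ suc n)        ≡⟨ cong -_ (ι-+ (suc m) (suc n)) ⟩
      - (ι (suc m) + ι (suc n))    ≡⟨ sym (⁻¹-∙-comm _ _) ⟩
      - ι (suc m) - ι (suc n)      ∎
      where open ≡-Reasoning

    ⟦+◃*⟧ : ∀ m i → ⟦ + m ℤ.* i ⟧ℤ ≡ ι m * ⟦ i ⟧ℤ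
    ⟦+◃*⟧ m (+ n)      = trans (cong ⟦_⟧ℤ (sym (ℤ.pos-* m n))) (ι-* m n)
    ⟦+◃*⟧ m (-[1+ n ]) = begin
      ⟦ + m ℤ.* (ℤ.- + suc n) ⟧ℤ   ≡⟨ cong ⟦_⟧ℤ (sym (ℤ.neg-distribʳ-* (+ m) (+ suc n))) ⟩
      ⟦ ℤ.- (+ m ℤ.* + suc n) ⟧ℤ   ≡⟨ ⟦-⟧ (+ m ℤ.* + suc n) ⟩
      - ⟦ + m ℤ.* + suc n ⟧ℤ       ≡⟨ cong -_ (⟦+◃*⟧ m (+ suc n)) ⟩
      - (ι m * ι (suc n))          ≡⟨ -‿distribʳ-* _ _ ⟩
      ι m * - ι (suc n)            ∎
      where open ≡-Reasoning

    ⟦*⟧ : ∀ i j → ⟦ i ℤ.* j ⟧ℤ ≡ ⟦ i ⟧ℤ * ⟦ j ⟧ℤ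
    ⟦*⟧ (+ m)      j = ⟦+◃*⟧ m j
    ⟦*⟧ (-[1+ m ]) j = begin
      ⟦ (ℤ.- + suc m) ℤ.* j ⟧ℤ     ≡⟨ cong ⟦_⟧ℤ (sym (ℤ.neg-distribˡ-* (+ suc m) j)) ⟩
      ⟦ ℤ.- (+ suc m ℤ.* j) ⟧ℤ     ≡⟨ ⟦-⟧ (+ suc m ℤ.* j) ⟩
      - ⟦ + suc m ℤ.* j ⟧ℤ         ≡⟨ cong -_ (⟦+◃*⟧ (suc m) j) ⟩
      - (ι (suc m) * ⟦ j ⟧ℤ)       ≡⟨ -‿distribˡ-* _ _ ⟩
      - ι (suc m) * ⟦ j ⟧ℤ         ∎
      where open ≡-Reasoning

    ℤ-rawRing : RawRing 0ℓ 0ℓ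
    ℤ-rawRing = CommutativeRing.rawRing ℤ.+-*-commutativeRing

    -- Equality in `Carrier` is not assumed decidable. Integer coefficients still let the solver
    -- compare numerals.
    ℤ⟶R : ℤ-rawRing -Raw-AlmostCommutative⟶ fromCommutativeRing commutativeRing
    ℤ⟶R = record
      { ⟦_⟧    = ⟦_⟧ℤ
      ; +-homo = ⟦+⟧
      ; *-homo = ⟦*⟧
      ; -‿homo = ⟦-⟧
      ; 0-homo = refl
      ; 1-homo = refl
      }

    coeff≟ : ∀ i j → Maybe (⟦ i ⟧ℤ ≡ ⟦ j ⟧ℤ)
    coeff≟ i j with i ℤ.≟ j
    ... | yes eq = just (cong ⟦_⟧ℤ eq)
    ... | no  _  = nothing

  open RingSolver ℤ-rawRing (fromCommutativeRing commutativeRing) ℤ⟶R coeff≟ public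
    using (Polynomial; solve; _:=_; _:+_; _:*_; _:-_; :-_; _:^_; con)

  :ι : ∀ {n} → ℕ → Polynomial n
  :ι n = con (+ n)

  :0 :1 : ∀ {n} → Polynomial n
  :0 = :ι 0
  :1 = :ι 1

  sum : ℕ → (ℕ → Carrier) → Carrier
  sum zero    f = 0#
  sum (suc n) f = sum n f + f n

  sum-cong : ∀ n {f g : ℕ → Carrier} → (∀ i → i ℕ.< n → f i ≡ g i) → sum n f ≡ sum n g
  sum-cong zero    eq = refl
  sum-cong (suc n) eq = cong₂ _+_ (sum-cong n (λ i i<n → eq i (ℕ.m<n⇒m<1+n i<n))) (eq n ℕ.≤-refl)

  sum-lin₂ : ∀ n a b f g → sum n (λ i → a * f i + b * g i) ≡ a * sum n f + b * sum n g
  sum-lin₂ zero    a b f g = solve 2 (λ a b → :0 := a :* :0 :+ b :* :0) refl a b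
  sum-lin₂ (suc n) a b f g = trans (cong (_+ (a * f n + b * g n)) (sum-lin₂ n a b f g))
    (solve 6 (λ a b F G x y → a :* F :+ b :* G :+ (a :* x :+ b :* y) := a :* (F :+ x) :+ b :* (G :+ y))
      refl a b (sum n f) (sum n g) (f n) (g n))

  sum-+ : ∀ n f g → sum n (λ i → f i + g i) ≡ sum n f + sum n g
  sum-+ n f g = trans (sum-cong n (λ i _ → unit (f i) (g i)))
    (trans (sum-lin₂ n 1# 1# f g) (sym (unit (sum n f) (sum n g))))
    where
    unit : ∀ x y → x + y ≡ 1# * x + 1# * y
    unit = solve 2 (λ x y → x :+ y := :1 :* x :+ :1 :* y) refl

  sum-* : ∀ n a f → sum n (λ i → a * f i) ≡ a * sum n f
  sum-* n a f = trans (sum-cong n (λ i _ → pad (f i))) (trans (sum-lin₂ n a 0# f f) (sym (pad (sum n f))))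
    where
    pad : ∀ x → a * x ≡ a * x + 0# * x
    pad = solve 2 (λ a x → a :* x := a :* x :+ :0 :* x) refl a

  sum-lin₃ : ∀ n a b c f g h →
    sum n (λ i → a * f i + b * g i + c * h i) ≡ a * sum n f + b * sum n g + c * sum n h
  sum-lin₃ n a b c f g h = trans (sum-+ n (λ i → a * f i + b * g i) (λ i → c * h i))
    (cong₂ _+_ (sum-lin₂ n a b f g) (sum-* n c h))

  sum-head : ∀ n f → sum (suc n) f ≡ f 0 + sum n (f ∘ suc)
  sum-head zero    f = +-comm 0# (f 0)
  sum-head (suc n) f = trans (cong (_+ f (suc n)) (sum-head n f)) (+-assoc _ _ _)

  sum-split : ∀ m n f → sum (m ℕ.+ n) f ≡ sum m f + sum n (λ i → f (m ℕ.+ i))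
  sum-split m zero    f = trans (cong (λ k → sum k f) (ℕ.+-identityʳ m)) (sym (+-identityʳ _))
  sum-split m (suc n) f = begin
    sum (m ℕ.+ suc n) f                                          ≡⟨ cong (λ k → sum k f) (ℕ.+-suc m n) ⟩
    sum (m ℕ.+ n) f + f (m ℕ.+ n)                                ≡⟨ cong (_+ f (m ℕ.+ n)) (sum-split m n f) ⟩
    sum m f + sum n (λ i → f (m ℕ.+ i)) + f (m ℕ.+ n)            ≡⟨ +-assoc _ _ _ ⟩
    sum m f + (sum n (λ i → f (m ℕ.+ i)) + f (m ℕ.+ n))          ∎
    where open ≡-Reasoning

  sum-reverse : ∀ n f → sum n f ≡ sum n (λ i → f (n ℕ.∸ suc i))
  sum-reverse zero    f = refl
  sum-reverse (suc n) f = begin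
    sum n f + f n                                ≡⟨ +-comm _ _ ⟩
    f n + sum n f                                ≡⟨ cong (_+_ (f n)) (sum-reverse n f) ⟩
    f n + sum n (λ i → f (n ℕ.∸ suc i))          ≡⟨ sym (sum-head n (λ i → f (n ℕ.∸ i))) ⟩
    sum (suc n) (λ i → f (n ℕ.∸ i))              ∎
    where open ≡-Reasoning

  sum-parity : ∀ n f → sum (n ℕ.+ n) f ≡ sum n (λ i → f (i ℕ.+ i) + f (suc (i ℕ.+ i)))
  sum-parity zero    f = refl
  sum-parity (suc n) f rewrite ℕ.+-suc n n = trans (+-assoc _ _ _) (cong (_+ (f (n ℕ.+ n) + f (suc (n ℕ.+ n)))) (sum-parity n f))

  sum-fold : ∀ m f → sum (m ℕ.+ m) f ≡ sum m (λ i → f i + f (m ℕ.+ m ℕ.∸ suc i))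
  sum-fold m f = begin
    sum (m ℕ.+ m) f                                                 ≡⟨ sum-split m m f ⟩
    sum m f + sum m (λ i → f (m ℕ.+ i))                             ≡⟨ cong (_+_ _) (sum-reverse m _) ⟩
    sum m f + sum m (λ i → f (m ℕ.+ (m ℕ.∸ suc i)))                 ≡⟨ cong (_+_ _) (sum-cong m (λ i i<m → cong f (sym (ℕ.+-∸-assoc m i<m)))) ⟩
    sum m f + sum m (λ i → f (m ℕ.+ m ℕ.∸ suc i))                   ≡⟨ sym (sum-+ m f _) ⟩
    sum m (λ i → f i + f (m ℕ.+ m ℕ.∸ suc i))                       ∎
    where open ≡-Reasoning

  recip-+ : ∀ {a b x y} → a * x ≡ 1# → b * y ≡ 1# → x + y ≡ (a + b) * (x * y)
  recip-+ {a} {b} {x} {y} ax by = begin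
    x + y                          ≡⟨ solve 2 (λ x y → x :+ y := x :* :1 :+ :1 :* y) refl x y ⟩
    x * 1# + 1# * y                ≡⟨ cong₂ (λ s t → x * s + t * y) (sym by) (sym ax) ⟩
    x * (b * y) + a * x * y        ≡⟨ solve 4 (λ a b x y → x :* (b :* y) :+ a :* x :* y
         := (a :+ b) :* (x :* y)) refl a b x y ⟩
    (a + b) * (x * y)              ∎
    where open ≡-Reasoning

  -- This serves in two ways: as partial fractions in `o*u`, and as the source of divisibility under
  -- reflections, where the two arguments add up to `p`, 2`p` or 3`p`.
  inv-+ : ∀ a b → inv (suc a) + inv (suc b) ≡ ι (suc a ℕ.+ suc b) * (inv (suc a) * inv (suc b))
  inv-+ a b = trans (recip-+ (ι-inv a) (ι-inv b))
    (cong (_* (inv (suc a) * inv (suc b))) (sym (ι-+ (suc a) (suc b))))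

  *-cancel-unit : ∀ {a b x y} → b * a ≡ 1# → a * x ≡ a * y → x ≡ y
  *-cancel-unit {a} {b} {x} {y} ba eq = trans (expand x) (trans (cong (_*_ b) eq) (sym (expand y)))
    where
    expand : ∀ z → z ≡ b * (a * z)
    expand z = trans (sym (*-identityˡ z)) (trans (cong (_* z) (sym ba)) (*-assoc b a z))

  -- In the usual indexing: u i = 1/(i+1), o i = 1/(2i+1), t i = 1/(2i+2).
  u o t : ℕ → Carrier
  u i = inv (suc i)
  o i = inv (suc (i ℕ.+ i))
  t i = inv (suc (suc (i ℕ.+ i)))

  u≡t+t : ∀ i → u i ≡ t i + t i
  u≡t+t i = sym (*-cancel-unit (trans (*-comm _ _) (ι-inv i)) (begin
    ι (suc i) * (t i + t i)        ≡⟨ solve 2 (λ a x → a :* (x :+ x)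
         := (a :+ a) :* x) refl (ι (suc i)) (t i) ⟩
    (ι (suc i) + ι (suc i)) * t i  ≡⟨ cong (_* t i) (sym (ι-+ (suc i) (suc i))) ⟩
    ι (suc (i ℕ.+ suc i)) * t i    ≡⟨ cong (λ k → ι (suc k) * t i) (ℕ.+-suc i i) ⟩
    ι (suc (suc (i ℕ.+ i))) * t i  ≡⟨ ι-inv (suc (i ℕ.+ i)) ⟩
    1#                             ≡⟨ sym (ι-inv i) ⟩
    ι (suc i) * u i                ∎))
    where open ≡-Reasoning

-- Exact identities between harmonic sums

module ExactSums (𝓡 : RationalAlgebra) where
  open Base 𝓡

  O T H : ℕ → Carrier
  O n = sum n o
  T n = sum n t
  H n = sum n u

  H-double : ∀ n → H (n ℕ.+ n) ≡ O n + T n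
  H-double n = trans (sum-parity n u) (sum-+ n o t)

  H-odd : ∀ n → H (suc (n ℕ.+ n)) ≡ O (suc n) + T n
  H-odd n = trans (cong (_+ o n) (H-double n)) (solve 3 (λ a b c → a :+ b :+ c
       := a :+ c :+ b) refl (O n) (T n) (o n))

  H≡T+T : ∀ n → H n ≡ T n + T n
  H≡T+T n = trans (sum-cong n (λ i _ → u≡t+t i)) (sum-+ n t t)

  -- Twice the second elementary symmetric function of the first `n` values of `f`; hence the simple
  -- increment in `F-suc`.
  F : (ℕ → Carrier) → ℕ → Carrier
  F f n = sum n f * sum n f - sum n (λ i → f i * f i)

  F-suc : ∀ f n → F f (suc n) ≡ F f n + ι 2 * (sum n f * f n)
  F-suc f n = solve 3 (λ s q x → (s :+ x) :* (s :+ x) :- (q :+ x :* x) := s :* s :- q :+ :ι 2 :* (s :* x))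
    refl (sum n f) (sum n (λ i → f i * f i)) (f n)

  -- With n = l + 1 these are the sums of O_i/(n-i) and O_i/i over 1 ≤ i < n. By partial fractions
  -- `C l + D l` is n times the sum of O_i/(i(n-i)).
  C D : ℕ → Carrier
  C l = sum l (λ i → O (suc i) * u (l ℕ.∸ suc i))
  D l = sum l (λ i → O (suc i) * u i)

  -- Partial fractions: (2i+1) + (2k+2) = 2(i+k+1) + 1 depends only on i + k, so in a convolution of
  -- `o` and `u` it comes out of the sum.
  o*u : ∀ i k → o i * u k ≡ ι 2 * o (suc (i ℕ.+ k)) * (o i + t k)
  o*u i k = sym (begin
    ι 2 * o (suc n) * (o i + t k)                           ≡⟨ cong (_*_ (ι 2 * o (suc n))) (inv-+ (i ℕ.+ i) (suc (k ℕ.+ k))) ⟩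
    ι 2 * o (suc n) * (ι (suc (i ℕ.+ i) ℕ.+ suc (suc (k ℕ.+ k))) * (o i * t k))
      ≡⟨ cong (λ m → ι 2 * o (suc n) * (ι m * (o i * t k))) (index i k) ⟩
    ι 2 * o (suc n) * (ι (suc (suc n ℕ.+ suc n)) * (o i * t k))
      ≡⟨ solve 4 (λ a x y z → :ι 2 :* x :* (a :* (y :* z))
           := (a :* x) :* (y :* (z :+ z))) refl (ι (suc (suc n ℕ.+ suc n))) (o (suc n)) (o i) (t k) ⟩
    (ι (suc (suc n ℕ.+ suc n)) * o (suc n)) * (o i * (t k + t k))
      ≡⟨ cong₂ (λ x y → x * (o i * y)) (ι-inv (suc n ℕ.+ suc n)) (sym (u≡t+t k)) ⟩
    1# * (o i * u k)                                        ≡⟨ solve 1 (λ x → :1 :* x := x) refl _ ⟩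
    o i * u k                                               ∎)
    where
    open ≡-Reasoning
    n = i ℕ.+ k
    index : ∀ i k → suc (i ℕ.+ i) ℕ.+ suc (suc (k ℕ.+ k)) ≡ suc (suc (i ℕ.+ k) ℕ.+ suc (i ℕ.+ k))
    index = solve-∀

  -- Splitting `O (suc i)` as `O i + o i` separates `C l`, shifted by one index because `O 0`
  -- vanishes, from the convolution of `o` and `u`, which `o*u` evaluates.
  C-suc : ∀ l → C (suc l) ≡ C l + ι 2 * o (suc l) * (O (suc l) + T (suc l))
  C-suc l = begin
    sum (suc l) (λ i → (O i + o i) * u (l ℕ.∸ i))
      ≡⟨ sum-cong (suc l) (λ { i (s≤s i≤l) → split i i≤l }) ⟩
    sum (suc l) (λ i → O i * u (l ℕ.∸ i) + ι 2 * o (suc l) * (o i + t (l ℕ.∸ i)))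
      ≡⟨ sum-+ (suc l) _ _ ⟩
    sum (suc l) (λ i → O i * u (l ℕ.∸ i)) + sum (suc l) (λ i → ι 2 * o (suc l) * (o i + t (l ℕ.∸ i)))
      ≡⟨ cong₂ _+_ (sum-head l (λ i → O i * u (l ℕ.∸ i))) (sum-* (suc l) (ι 2 * o (suc l)) _) ⟩
    0# * u l + C l + ι 2 * o (suc l) * sum (suc l) (λ i → o i + t (l ℕ.∸ i))
      ≡⟨ cong₂ _+_ (solve 2 (λ x c → :0 :* x :+ c := c) refl (u l) (C l))
                   (cong (_*_ (ι 2 * o (suc l))) (trans (sum-+ (suc l) o _) (cong (_+_ (O (suc l))) (sym (sum-reverse (suc l) t))))) ⟩
    C l + ι 2 * o (suc l) * (O (suc l) + T (suc l)) ∎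
    where
    open ≡-Reasoning
    split : ∀ i → i ℕ.≤ l → (O i + o i) * u (l ℕ.∸ i) ≡ O i * u (l ℕ.∸ i) + ι 2 * o (suc l) * (o i + t (l ℕ.∸ i))
    split i i≤l = trans (solve 3 (λ a b c → (a :+ b) :* c := a :* c :+ b :* c) refl (O i) (o i) (u (l ℕ.∸ i)))
      (cong (_+_ (O i * u (l ℕ.∸ i))) (trans (o*u i (l ℕ.∸ i))
        (cong (λ k → ι 2 * o (suc k) * (o i + t (l ℕ.∸ i))) (ℕ.m+[n∸m]≡n i≤l))))

  -- Since `t` is half of `u`, `F t l` is a quarter of `F u l`. Raising `l` by one adds the
  -- reciprocals of 2l+2 and 2l+3 to the range of `F u`; writing the harmonic numbers in front of
  -- them through `O` and `T` matches the increments of `C`, `D` and `F t`.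
  C+D : ∀ l → C l + D l ≡ F u (suc (l ℕ.+ l)) - F t l
  C+D zero = solve 1 (λ x → :0 :+ :0
       := ((:0 :+ x) :* (:0 :+ x) :- (:0 :+ x :* x)) :- (:0 :* :0 :- :0)) refl (u 0)
  C+D (suc l) = begin
    C (suc l) + (D l + O (suc l) * u l)
      ≡⟨ cong₂ (λ x y → x + (D l + O (suc l) * y)) (C-suc l) (u≡t+t l) ⟩
    C l + ι 2 * o (suc l) * (O (suc l) + T (suc l)) + (D l + O (suc l) * (t l + t l))
      ≡⟨ solve 7 (λ c d a b τ o t → c :+ :ι 2 :* o :* (a :+ b) :+ (d :+ a :* (t :+ t))
                := c :+ d :+ :ι 2 :* ((a :+ τ) :* t) :+ :ι 2 :* ((a :+ b) :* o) :- :ι 2 :* (τ :* t))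
           refl (C l) (D l) (O (suc l)) (T (suc l)) (T l) (o (suc l)) (t l) ⟩
    C l + D l + ι 2 * ((O (suc l) + T l) * t l) + ι 2 * ((O (suc l) + T (suc l)) * o (suc l)) - ι 2 * (T l * t l)
      ≡⟨ cong (λ z → z + ι 2 * ((O (suc l) + T l) * t l) + ι 2 * ((O (suc l) + T (suc l)) * o (suc l)) - ι 2 * (T l * t l)) (C+D l) ⟩
    F u n - F t l + ι 2 * ((O (suc l) + T l) * t l) + ι 2 * ((O (suc l) + T (suc l)) * o (suc l)) - ι 2 * (T l * t l)
      ≡⟨ solve 5 (λ a b x y z → a :- b :+ x :+ y :- z := a :+ x :+ y :- (b :+ z)) refl (F u n) (F t l) _ _ _ ⟩
    F u n + ι 2 * ((O (suc l) + T l) * t l) + ι 2 * ((O (suc l) + T (suc l)) * o (suc l)) - (F t l + ι 2 * (T l * t l))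
      ≡⟨ cong₂ _-_ (sym Fu-step) (sym (F-suc t l)) ⟩
    F u (suc (suc l ℕ.+ suc l)) - F t (suc l) ∎
    where
    open ≡-Reasoning
    n = suc (l ℕ.+ l)
    Fu-step : F u (suc (suc l ℕ.+ suc l)) ≡
      F u n + ι 2 * ((O (suc l) + T l) * t l) + ι 2 * ((O (suc l) + T (suc l)) * o (suc l))
    Fu-step = begin
      F u (suc (suc l ℕ.+ suc l))
        ≡⟨ F-suc u (suc l ℕ.+ suc l) ⟩
      F u (suc l ℕ.+ suc l) + ι 2 * (H (suc l ℕ.+ suc l) * o (suc l))
        ≡⟨ cong₂ (λ x y → x + ι 2 * (y * o (suc l))) (trans (cong (λ k → F u (suc k)) (ℕ.+-suc l l)) (F-suc u n)) (H-double (suc l)) ⟩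
      F u n + ι 2 * (H n * t l) + ι 2 * ((O (suc l) + T (suc l)) * o (suc l))
        ≡⟨ cong (λ x → F u n + ι 2 * (x * t l) + ι 2 * ((O (suc l) + T (suc l)) * o (suc l))) (H-odd l) ⟩
      F u n + ι 2 * ((O (suc l) + T l) * t l) + ι 2 * ((O (suc l) + T (suc l)) * o (suc l)) ∎

  -- The right-hand side is a sum over pairs (i, j) of `g i * o j`; the two sums on the left collect
  -- the pairs with i < j and those with j ≤ i.
  abel : ∀ g l → sum (suc l) (λ j → o j * sum j g) + sum l (λ i → O (suc i) * g i) ≡ sum l g * O (suc l)
  abel g zero    = solve 1 (λ x → :0 :+ x :* :0 :+ :0 := :0 :* (:0 :+ x)) refl (o 0)
  abel g (suc l) = begin
    S + x * (G + y) + (R + O (suc l) * y)   ≡⟨ solve 6 (λ S R x G y O → S :+ x :* (G :+ y) :+ (R :+ O :* y)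
         := S :+ R :+ (x :* (G :+ y) :+ O :* y)) refl S R x G y (O (suc l)) ⟩
    S + R + (x * (G + y) + O (suc l) * y)   ≡⟨ cong (_+ (x * (G + y) + O (suc l) * y)) (abel g l) ⟩
    G * O (suc l) + (x * (G + y) + O (suc l) * y)  ≡⟨ solve 4 (λ x G y O → G :* O :+ (x :* (G :+ y) :+ O :* y)
         := (G :+ y) :* (O :+ x)) refl x G y (O (suc l)) ⟩
    (G + y) * (O (suc l) + x)               ∎
    where
    open ≡-Reasoning
    S = sum (suc l) (λ j → o j * sum j g)
    R = sum l (λ i → O (suc i) * g i)
    x = o (suc l)
    y = g l
    G = sum l g

-- The absorption identity for binomial coefficients

nC0≡1 : ∀ n → n C 0 ≡ 1
nC0≡1 n = trans (nCk≡nC[n∸k] {0} {n} z≤n) (nCn≡1 n)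

absorption : ∀ n k → suc k ℕ.* (suc n C suc k) ≡ suc n ℕ.* (n C k)
absorption zero    zero    = refl
absorption zero    (suc k) = trans (cong (suc (suc k) ℕ.*_) (k>n⇒nCk≡0 {1} {suc (suc k)} (s≤s (s≤s z≤n))))
  (trans (ℕ.*-zeroʳ (suc (suc k))) (sym (cong (1 ℕ.*_) (k>n⇒nCk≡0 {0} {suc k} (s≤s z≤n)))))
absorption (suc n) zero = begin
  1 ℕ.* (suc (suc n) C 1)                ≡⟨ cong (1 ℕ.*_) (sym (nCk+nC[k+1]≡[n+1]C[k+1] (suc n) 0)) ⟩
  1 ℕ.* ((suc n C 0) ℕ.+ (suc n C 1))    ≡⟨ cong₂ (λ a b → 1 ℕ.* (a ℕ.+ b)) (nC0≡1 (suc n)) (trans (sym (ℕ.*-identityˡ _)) (absorption n 0)) ⟩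
  1 ℕ.* (1 ℕ.+ suc n ℕ.* (n C 0))        ≡⟨ cong (λ a → 1 ℕ.* (1 ℕ.+ suc n ℕ.* a)) (nC0≡1 n) ⟩
  1 ℕ.* (1 ℕ.+ suc n ℕ.* 1)              ≡⟨ shift n ⟩
  suc (suc n) ℕ.* 1                      ≡⟨ cong (suc (suc n) ℕ.*_) (sym (nC0≡1 (suc n))) ⟩
  suc (suc n) ℕ.* (suc n C 0)            ∎
  where
  open ≡-Reasoning
  shift : ∀ n → 1 ℕ.* (1 ℕ.+ suc n ℕ.* 1) ≡ suc (suc n) ℕ.* 1
  shift = solve-∀
absorption (suc n) (suc k) = begin
  suc (suc k) ℕ.* (suc (suc n) C suc (suc k))       ≡⟨ cong (suc (suc k) ℕ.*_) (sym (nCk+nC[k+1]≡[n+1]C[k+1] (suc n) (suc k))) ⟩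
  suc (suc k) ℕ.* (a ℕ.+ (suc n C suc (suc k)))     ≡⟨ expand k a _ ⟩
  a ℕ.+ suc k ℕ.* a ℕ.+ suc (suc k) ℕ.* (suc n C suc (suc k))
                                                    ≡⟨ cong₂ (λ x y → a ℕ.+ x ℕ.+ y) (absorption n k) (absorption n (suc k)) ⟩
  a ℕ.+ suc n ℕ.* (n C k) ℕ.+ suc n ℕ.* (n C suc k) ≡⟨ collect n a (n C k) (n C suc k) ⟩
  a ℕ.+ suc n ℕ.* ((n C k) ℕ.+ (n C suc k))         ≡⟨ cong (λ z → a ℕ.+ suc n ℕ.* z) (nCk+nC[k+1]≡[n+1]C[k+1] n k) ⟩
  suc (suc n) ℕ.* a                                 ∎
  where
  open ≡-Reasoning
  a = suc n C suc k
  expand : ∀ k a b → suc (suc k) ℕ.* (a ℕ.+ b) ≡ a ℕ.+ suc k ℕ.* a ℕ.+ suc (suc k) ℕ.* b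
  expand = solve-∀
  collect : ∀ n a x y → a ℕ.+ suc n ℕ.* x ℕ.+ suc n ℕ.* y ≡ a ℕ.+ suc n ℕ.* (x ℕ.+ y)
  collect = solve-∀

-- Telescoping the weighted sum of Apéry numbers

module AperySum (𝓡 : RationalAlgebra) where
  open Base 𝓡

  private
    c : ℕ → ℕ → Carrier
    c n k = ι (n C k)

  c-absorb : ∀ n k → ι (suc k) * c (suc n) (suc k) ≡ ι (suc n) * c n k
  c-absorb n k = trans (sym (ι-* (suc k) (suc n C suc k))) (trans (cong ι (absorption n k)) (ι-* (suc n) (n C k)))

  c-upper : ∀ n k → (ι (suc n) - ι k) * c (suc n) k ≡ ι (suc n) * c n k
  c-upper n zero = begin
    (ι (suc n) - 0#) * c (suc n) 0  ≡⟨ cong (λ z → (ι (suc n) - 0#) * ι z) (trans (nC0≡1 (suc n)) (sym (nC0≡1 n))) ⟩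
    (ι (suc n) - 0#) * c n 0        ≡⟨ solve 2 (λ a x → (a :- :0) :* x := a :* x) refl (ι (suc n)) (c n 0) ⟩
    ι (suc n) * c n 0               ∎
    where open ≡-Reasoning
  c-upper n (suc k) = begin
    (N - K) * c (suc n) (suc k)                        ≡⟨ solve 3 (λ N K x → (N :- K) :* x
         := N :* x :- K :* x) refl N K (c (suc n) (suc k)) ⟩
    N * c (suc n) (suc k) - K * c (suc n) (suc k)      ≡⟨ cong₂ (λ x y → N * x - y) pascal (c-absorb n k) ⟩
    N * (c n k + c n (suc k)) - N * c n k              ≡⟨ solve 3 (λ N x y → N :* (x :+ y) :- N :* x
         := N :* y) refl N (c n k) (c n (suc k)) ⟩
    N * c n (suc k)                                    ∎
    where
    open ≡-Reasoning
    N = ι (suc n)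
    K = ι (suc k)
    pascal : c (suc n) (suc k) ≡ c n k + c n (suc k)
    pascal = trans (cong ι (sym (nCk+nC[k+1]≡[n+1]C[k+1] n k))) (ι-+ (n C k) (n C suc k))

  -- Subtraction in the ring is not truncated, so no bound on `k` is needed: for k ≥ n both sides
  -- vanish.
  c-lower : ∀ n k → ι (suc k) * c n (suc k) ≡ (ι n - ι k) * c n k
  c-lower zero zero = begin
    1# * c 0 1         ≡⟨⟩
    1# * 0#            ≡⟨ solve 0 (:1 :* :0 := (:0 :- :0) :* :1) refl ⟩
    (0# - 0#) * 1#     ∎
    where open ≡-Reasoning
  c-lower zero (suc k) = begin
    ι (suc (suc k)) * c 0 (suc (suc k))   ≡⟨ cong (λ z → ι (suc (suc k)) * ι z) (k>n⇒nCk≡0 {0} {suc (suc k)} (s≤s z≤n)) ⟩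
    ι (suc (suc k)) * 0#                  ≡⟨ solve 2 (λ a b → a :* :0 := b :* :0) refl _ (0# - ι (suc k)) ⟩
    (0# - ι (suc k)) * 0#                 ≡⟨ cong (λ z → (0# - ι (suc k)) * ι z) (sym (k>n⇒nCk≡0 {0} {suc k} (s≤s z≤n))) ⟩
    (0# - ι (suc k)) * c 0 (suc k)        ∎
    where open ≡-Reasoning
  c-lower (suc n) k = trans (c-absorb n k) (sym (c-upper n k))

  -- W n j = n Π_{1≤i≤j} (n²/i² - 1), the telescoping quantity.
  b W : ℕ → ℕ → Carrier
  b n j = c (n ℕ.+ j) j * c n j
  W n j = (ι n - ι j) * b n j

  W-suc-n : ∀ n j → W (suc n) j ≡ (ι (suc n) + ι j) * b n j
  W-suc-n n j = begin
    (N - J) * (x * c (suc n) j)     ≡⟨ solve 4 (λ N J x y → (N :- J) :* (x :* y)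
         := x :* ((N :- J) :* y)) refl N J x (c (suc n) j) ⟩
    x * ((N - J) * c (suc n) j)     ≡⟨ cong (_*_ x) (c-upper n j) ⟩
    x * (N * c n j)                 ≡⟨ solve 4 (λ N J x y → x :* (N :* y)
         := ((N :+ J) :- J) :* x :* y) refl N J x (c n j) ⟩
    (N + J - J) * x * c n j         ≡⟨ cong (λ z → (z - J) * x * c n j) (sym (ι-+ (suc n) j)) ⟩
    (ι (suc (n ℕ.+ j)) - J) * x * c n j  ≡⟨ cong (_* c n j) (c-upper (n ℕ.+ j) j) ⟩
    ι (suc (n ℕ.+ j)) * c (n ℕ.+ j) j * c n j ≡⟨ cong (λ z → z * c (n ℕ.+ j) j * c n j) (ι-+ (suc n) j) ⟩
    (N + J) * c (n ℕ.+ j) j * c n j ≡⟨ solve 3 (λ a x y → a :* x :* y := a :* (x :* y)) refl (N + J) _ _ ⟩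
    (N + J) * b n j                 ∎
    where
    open ≡-Reasoning
    N = ι (suc n)
    J = ι j
    x = c (suc n ℕ.+ j) j

  W-suc-j : ∀ n j → W n (suc j) ≡ (ι n * ι n * (u j * u j) - 1#) * W n j
  W-suc-j n j = begin
    W n (suc j)                                  ≡⟨ solve 1 (λ w → w := :1 :* :1 :* w) refl (W n (suc j)) ⟩
    1# * 1# * W n (suc j)                        ≡⟨ cong (λ z → z * z * W n (suc j)) (sym (ι-inv j)) ⟩
    (J′ * v) * (J′ * v) * ((N - J′) * (c (n ℕ.+ suc j) (suc j) * c n (suc j)))
       ≡⟨ solve 5 (λ J′ v N x y → (J′ :* v) :* (J′ :* v) :* ((N :- J′) :* (x :* y))
            := v :* v :* (N :- J′) :* ((J′ :* x) :* (J′ :* y))) refl J′ v N _ _ ⟩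
    v * v * (N - J′) * ((J′ * c (n ℕ.+ suc j) (suc j)) * (J′ * c n (suc j)))
       ≡⟨ cong₂ (λ x y → v * v * (N - J′) * (x * y)) absorb (c-lower n j) ⟩
    v * v * (N - J′) * (((N + J′) * c (n ℕ.+ j) j) * ((N - J) * c n j))
       ≡⟨ solve 6 (λ J′ J v N x y → v :* v :* (N :- J′) :* (((N :+ J′) :* x) :* ((N :- J) :* y))
                                 := (N :* N :* (v :* v) :- (J′ :* v) :* (J′ :* v)) :* ((N :- J) :* (x :* y)))
                                 refl J′ J v N _ _ ⟩
    (N * N * (v * v) - (J′ * v) * (J′ * v)) * W n j  ≡⟨ cong (λ z → (N * N * (v * v) - z * z) * W n j) (ι-inv j) ⟩
    (N * N * (v * v) - 1# * 1#) * W n j          ≡⟨ solve 2 (λ a w → (a :- :1 :* :1) :* w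
         := (a :- :1) :* w) refl _ _ ⟩
    (N * N * (v * v) - 1#) * W n j               ∎
    where
    open ≡-Reasoning
    N = ι n
    J = ι j
    J′ = ι (suc j)
    v = u j
    absorb : J′ * c (n ℕ.+ suc j) (suc j) ≡ (N + J′) * c (n ℕ.+ j) j
    absorb = begin
      J′ * c (n ℕ.+ suc j) (suc j)       ≡⟨ cong (λ k → J′ * c k (suc j)) (ℕ.+-suc n j) ⟩
      J′ * c (suc (n ℕ.+ j)) (suc j)     ≡⟨ c-absorb (n ℕ.+ j) j ⟩
      ι (suc (n ℕ.+ j)) * c (n ℕ.+ j) j  ≡⟨ cong (_* c (n ℕ.+ j) j) (trans (cong ι (sym (ℕ.+-suc n j))) (ι-+ n (suc j))) ⟩
      (N + J′) * c (n ℕ.+ j) j           ∎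

  q : Carrier → ℕ → Carrier
  q P zero    = 1#
  q P (suc j) = (1# - P * P * (u j * u j)) * (1# - P * P * (u j * u j)) * q P j

  -- Each step in `j` multiplies `W` by n²/i² - 1, the negative of the factor in `q`; squaring
  -- removes the sign.
  W² : ∀ n j → W n j * W n j ≡ ι n * ι n * q (ι n) j
  W² n zero = begin
    W n 0 * W n 0                               ≡⟨ cong (λ z → z * z) (cong₂ (λ x y → (ι n - 0#) * (ι x * ι y)) (nC0≡1 (n ℕ.+ 0)) (nC0≡1 n)) ⟩
    ((ι n - 0#) * (1# * 1#)) * ((ι n - 0#) * (1# * 1#))  ≡⟨ solve 1 (λ N → ((N :- :0) :* (:1 :* :1)) :* ((N :- :0) :* (:1 :* :1))
         := N :* N :* :1) refl (ι n) ⟩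
    ι n * ι n * 1#                              ∎
    where open ≡-Reasoning
  W² n (suc j) = begin
    W n (suc j) * W n (suc j)                   ≡⟨ cong (λ z → z * z) (W-suc-j n j) ⟩
    ((a - 1#) * W n j) * ((a - 1#) * W n j)     ≡⟨ solve 2 (λ a w → ((a :- :1) :* w) :* ((a :- :1) :* w)
         := (:1 :- a) :* (:1 :- a) :* (w :* w)) refl a (W n j) ⟩
    (1# - a) * (1# - a) * (W n j * W n j)       ≡⟨ cong (_*_ ((1# - a) * (1# - a))) (W² n j) ⟩
    (1# - a) * (1# - a) * (ι n * ι n * q (ι n) j)  ≡⟨ solve 3 (λ f N q → f :* (N :* N :* q)
         := N :* N :* (f :* q)) refl ((1# - a) * (1# - a)) (ι n) (q (ι n) j) ⟩
    ι n * ι n * ((1# - a) * (1# - a) * q (ι n) j)  ∎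
    where
    open ≡-Reasoning
    a = ι n * ι n * (u j * u j)

  ι-odd : ∀ k → ι (2 ℕ.* k ℕ.+ 1) ≡ ι k + ι k + 1#
  ι-odd k = trans (ι-+ (2 ℕ.* k) 1) (cong (_+ 1#) (trans (cong ι (cong (k ℕ.+_) (ℕ.+-identityʳ k))) (ι-+ k k)))

  -- By `W-suc-n` the increment is a difference of squares, (n+1+j)² - (n-j)² = (2n+1)(2j+1), times
  -- `b n j` squared; `o j` cancels 2j+1.
  W²-step : ∀ n j → W (suc n) j * W (suc n) j * o j ≡ W n j * W n j * o j + ι (2 ℕ.* n ℕ.+ 1) * (b n j * b n j)
  W²-step n j = begin
    W (suc n) j * W (suc n) j * o j
      ≡⟨ cong (λ z → z * z * o j) (trans (W-suc-n n j) (cong (λ z → (z + J) * b n j) (ι-suc n))) ⟩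
    ((1# + N + J) * b n j) * ((1# + N + J) * b n j) * o j
      ≡⟨ solve 4 (λ N J b o → ((:1 :+ N :+ J) :* b) :* ((:1 :+ N :+ J) :* b) :* o
             := ((N :- J) :* b) :* ((N :- J) :* b) :* o :+ (N :+ N :+ :1) :* (b :* b) :* ((:1 :+ (J :+ J)) :* o))
             refl N J (b n j) (o j) ⟩
    W n j * W n j * o j + (N + N + 1#) * (b n j * b n j) * ((1# + (J + J)) * o j)
      ≡⟨ cong₂ (λ x y → W n j * W n j * o j + x * (b n j * b n j) * y) (sym (ι-odd n)) odd-inv ⟩
    W n j * W n j * o j + ι (2 ℕ.* n ℕ.+ 1) * (b n j * b n j) * 1#
      ≡⟨ solve 2 (λ x y → x :+ y :* :1 := x :+ y) refl _ _ ⟩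
    W n j * W n j * o j + ι (2 ℕ.* n ℕ.+ 1) * (b n j * b n j) ∎
    where
    open ≡-Reasoning
    N = ι n
    J = ι j
    odd-inv : (1# + (J + J)) * o j ≡ 1#
    odd-inv = trans (cong (_* o j) (sym (trans (ι-suc (j ℕ.+ j)) (cong (_+_ 1#) (ι-+ j j))))) (ι-inv (j ℕ.+ j))

  ι-sumℕ : ∀ n f → ι (sumℕ n f) ≡ sum n (λ i → ι (f i))
  ι-sumℕ zero    f = refl
  ι-sumℕ (suc n) f = trans (ι-+ (sumℕ n f) (f n)) (cong (_+ ι (f n)) (ι-sumℕ n f))

  ι-apery : ∀ n → ι (apery n) ≡ sum (suc n) (λ j → b n j * b n j)
  ι-apery n = trans (ι-sumℕ (suc n) _) (sum-cong (suc n) (λ j _ → term j))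
    where
    square : ∀ a → ι (a ℕ.^ 2) ≡ ι a * ι a
    square a = trans (cong ι (cong (a ℕ.*_) (ℕ.*-identityʳ a))) (ι-* a a)
    term : ∀ j → ι (((n ℕ.+ j) C j) ℕ.^ 2 ℕ.* (n C j) ℕ.^ 2) ≡ b n j * b n j
    term j = trans (ι-* (((n ℕ.+ j) C j) ℕ.^ 2) ((n C j) ℕ.^ 2)) (trans (cong₂ _*_ (square ((n ℕ.+ j) C j)) (square (n C j)))
      (solve 2 (λ x y → x :* x :* (y :* y) := (x :* y) :* (x :* y)) refl (c (n ℕ.+ j) j) (c n j)))

  apery-sum : ∀ n → sum n (λ k → ι ((2 ℕ.* k ℕ.+ 1) ℕ.* apery k)) ≡ sum n (λ j → W n j * W n j * o j)
  apery-sum zero    = refl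
  apery-sum (suc n) = begin
    sum n (λ k → ι ((2 ℕ.* k ℕ.+ 1) ℕ.* apery k)) + ι ((2 ℕ.* n ℕ.+ 1) ℕ.* apery n)
      ≡⟨ cong₂ _+_ (apery-sum n) (trans (ι-* (2 ℕ.* n ℕ.+ 1) (apery n)) (cong (_*_ ω) (ι-apery n))) ⟩
    sum n (λ j → W n j * W n j * o j) + ω * sum (suc n) (λ j → b n j * b n j)
      -- `W n n` contains the factor n - n, so the sum extends for free to j = n, the last index of
      -- `apery n`.
      ≡⟨ cong (_+ ω * sum (suc n) (λ j → b n j * b n j)) (sym top) ⟩
    sum (suc n) (λ j → W n j * W n j * o j) + ω * sum (suc n) (λ j → b n j * b n j)
      ≡⟨ cong (_+_ _) (sym (sum-* (suc n) ω _)) ⟩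
    sum (suc n) (λ j → W n j * W n j * o j) + sum (suc n) (λ j → ω * (b n j * b n j))
      ≡⟨ sym (sum-+ (suc n) _ _) ⟩
    sum (suc n) (λ j → W n j * W n j * o j + ω * (b n j * b n j))
      ≡⟨ sum-cong (suc n) (λ j _ → sym (W²-step n j)) ⟩
    sum (suc n) (λ j → W (suc n) j * W (suc n) j * o j) ∎
    where
    open ≡-Reasoning
    ω = ι (2 ℕ.* n ℕ.+ 1)
    top : sum n (λ j → W n j * W n j * o j) + W n n * W n n * o n ≡ sum n (λ j → W n j * W n j * o j)
    top = solve 4 (λ s N b o → s :+ ((N :- N) :* b) :* ((N :- N) :* b) :* o := s) refl _ (ι n) (b n n) (o n)

-- p-integral elements and divisibility by powers of p

record PIntegral (𝓡 : RationalAlgebra) (p : ℕ) : Set₁ where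
  open RationalAlgebra 𝓡
  infixl 6 _⊕_
  infixl 7 _⊗_
  infix  8 ⊝_
  field
    Integral : Carrier → Set
    _⊕_      : ∀ {x y} → Integral x → Integral y → Integral (x + y)
    _⊗_      : ∀ {x y} → Integral x → Integral y → Integral (x * y)
    ⊝_       : ∀ {x} → Integral x → Integral (- x)
    0-int    : Integral 0#
    1-int    : Integral 1#
    inv-int  : ∀ {n} → ¬ p ∣ n → Integral (inv n)

module Divisible (𝓡 : RationalAlgebra) (p : ℕ) (𝓘 : PIntegral 𝓡 p) where
  open Base 𝓡
  open PIntegral 𝓘 public

  P : Carrier
  P = ι p

  ι-int : ∀ n → Integral (ι n)
  ι-int zero          = 0-int
  ι-int (suc zero)    = 1-int
  ι-int (suc (suc n)) = 1-int ⊕ ι-int (suc n)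

  P-int : Integral P
  P-int = ι-int p

  sum-int : ∀ n {f} → (∀ i → i ℕ.< n → Integral (f i)) → Integral (sum n f)
  sum-int zero    h = 0-int
  sum-int (suc n) h = sum-int n (λ i i<n → h i (ℕ.m<n⇒m<1+n i<n)) ⊕ h n ℕ.≤-refl

  -- Congruence modulo p^k is expressed as `Div k` of a difference. Only the quotient has to be
  -- integral, so terms such as `O p` and 1/p, which are not, may occur in the difference.
  record Div (k : ℕ) (x : Carrier) : Set where
    constructor div
    field
      quotient : Carrier
      integral : Integral quotient
      factors  : x ≡ P ^ k * quotient

  Div-resp : ∀ {k x y} → x ≡ y → Div k x → Div k y
  Div-resp eq (div c ic e) = div c ic (trans (sym eq) e)

  Div-lin : ∀ {k a b x y} → Integral a → Integral b → Div k x → Div k y → Div k (a * x + b * y)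
  Div-lin {k} {a} {b} ia ib (div c ic refl) (div d id refl) =
    div (a * c + b * d) (ia ⊗ ic ⊕ ib ⊗ id)
    (solve 5 (λ a b c d Q → a :* (Q :* c) :+ b :* (Q :* d) := Q :* (a :* c :+ b :* d)) refl a b c d (P ^ k))

  Div-scale : ∀ {k a x} → Integral a → Div k x → Div k (a * x)
  Div-scale {k} {a} ia (div c ic refl) =
    div (a * c) (ia ⊗ ic) (solve 3 (λ a c Q → a :* (Q :* c) := Q :* (a :* c)) refl a c (P ^ k))

  Div-+ : ∀ {k x y} → Div k x → Div k y → Div k (x + y)
  Div-+ {k} (div c ic refl) (div d id refl) =
    div (c + d) (ic ⊕ id) (solve 3 (λ c d Q → Q :* c :+ Q :* d := Q :* (c :+ d)) refl c d (P ^ k))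

  Div-* : ∀ {j k x y} → Div j x → Div k y → Div (j ℕ.+ k) (x * y)
  Div-* {j} {k} (div c ic refl) (div d id refl) = div (c * d) (ic ⊗ id)
    (trans (solve 4 (λ A B c d → A :* c :* (B :* d) := A :* B :* (c :* d)) refl (P ^ j) (P ^ k) c d)
          (cong (_* (c * d)) (sym (^-homo-* P j k))))

  Div-P^ : ∀ k → Div k (P ^ k)
  Div-P^ k = div 1# 1-int (solve 1 (λ Q → Q := Q :* :1) refl (P ^ k))

  Div-sum : ∀ n {k f} → (∀ i → i ℕ.< n → Div k (f i)) → Div k (sum n f)
  Div-sum zero    {k} h = div 0# 0-int (solve 1 (λ Q → :0 := Q :* :0) refl (P ^ k))
  Div-sum (suc n) h = Div-+ (Div-sum n (λ i i<n → h i (ℕ.m<n⇒m<1+n i<n))) (h n ℕ.≤-refl)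

  Div-pred : ∀ {k x} → Div (suc k) x → Div k x
  Div-pred {k} (div c ic refl) = div (P * c) (P-int ⊗ ic)
    (solve 3 (λ P c Q → P :* Q :* c := Q :* (P :* c)) refl P c (P ^ k))

  Div⇒Integral : ∀ {x} → Div 0 x → Integral x
  Div⇒Integral (div c ic refl) = 1-int ⊗ ic

  Div-cancel : ∀ {k x} n → ¬ p ∣ suc n → Div k (ι (suc n) * x) → Div k x
  Div-cancel {k} {x} n p∤n d = Div-resp eq (Div-scale (inv-int p∤n) d)
    where
    eq : inv (suc n) * (ι (suc n) * x) ≡ x
    eq = trans (solve 3 (λ i a x → i :* (a :* x) := (a :* i) :* x) refl (inv (suc n)) (ι (suc n)) x)
      (trans (cong (_* x) (ι-inv n)) (solve 1 (λ x → :1 :* x := x) refl x))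

-- Reciprocals of two numbers with sum P

module Reflection (𝓡 : RationalAlgebra) where
  open Base 𝓡

  -- rel holds for the reciprocals x and y of two numbers with sum P.
  module _ {P x y : Carrier} (rel : x + y ≡ P * (x * y)) where

    -- The relation says x = -y(1 - Px), so y² is x²/(1 - Px)², expanded here to second order. The
    -- exact remainder comes from (1 + 2z + 3z²)(1 - z)² = 1 - 4z³ + 3z⁴ at z = Px.
    reflect-square : y * y - (x * x + ι 2 * P * (x * x * x) + ι 3 * P * P * (x * x * (x * x)))
      ≡ P ^ 3 * (y * y * (x * x * x) * (ι 4 - ι 3 * P * x))
    reflect-square = begin
      y * y - (x * x + ι 2 * P * (x * x * x) + ι 3 * P * P * (x * x * (x * x)))
        ≡⟨ solve 3 (λ P x y → y :* y :- (x :* x :+ :ι 2 :* P :* (x :* x :* x) :+ :ι 3 :* P :* P :* (x :* x :* (x :* x)))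
                           := y :* y :- x :* x :* (:1 :+ :ι 2 :* P :* x :+ :ι 3 :* P :* P :* (x :* x)))
                           refl P x y ⟩
      y * y - x * x * (1# + ι 2 * P * x + ι 3 * P * P * (x * x))
        ≡⟨ cong (λ z → y * y - z * z * (1# + ι 2 * P * x + ι 3 * P * P * (x * x))) x≡ ⟩
      y * y - (P * (x * y) - y) * (P * (x * y) - y) * (1# + ι 2 * P * x + ι 3 * P * P * (x * x))
        ≡⟨ solve 3 (λ P x y → y :* y :- (P :* (x :* y) :- y) :* (P :* (x :* y) :- y) :* (:1 :+ :ι 2 :* P :* x :+ :ι 3 :* P :* P :* (x :* x))
                           := P :^ 3 :* (y :* y :* (x :* x :* x) :* (:ι 4 :- :ι 3 :* P :* x))) refl P x y ⟩
      P ^ 3 * (y * y * (x * x * x) * (ι 4 - ι 3 * P * x)) ∎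
      where
      open ≡-Reasoning
      x≡ : x ≡ P * (x * y) - y
      x≡ = trans (solve 2 (λ x y → x := x :+ y :- y) refl x y) (cong (_- y) rel)

    reflect-fourth : y * y * (y * y) - x * x * (x * x) ≡ P ^ 1 * (x * y * (y - x) * (x * x + y * y))
    reflect-fourth = begin
      y * y * (y * y) - x * x * (x * x)       ≡⟨ solve 2 (λ x y → y :* y :* (y :* y) :- x :* x :* (x :* x)
           := (x :+ y) :* ((y :- x) :* (x :* x :+ y :* y))) refl x y ⟩
      (x + y) * ((y - x) * (x * x + y * y))   ≡⟨ cong (_* ((y - x) * (x * x + y * y))) rel ⟩
      P * (x * y) * ((y - x) * (x * x + y * y)) ≡⟨ solve 3 (λ P x y → P :* (x :* y) :* ((y :- x) :* (x :* x :+ y :* y))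
           := P :^ 1 :* (x :* y :* (y :- x) :* (x :* x :+ y :* y))) refl P x y ⟩
      P ^ 1 * (x * y * (y - x) * (x * x + y * y)) ∎
      where open ≡-Reasoning

    reflect-product : x * y * (x * y) - x * x * (x * x) ≡ P ^ 1 * (x * x * (x * y) * (y - x))
    reflect-product = begin
      x * y * (x * y) - x * x * (x * x)     ≡⟨ solve 2 (λ x y → x :* y :* (x :* y) :- x :* x :* (x :* x)
           := (x :+ y) :* (x :* x :* (y :- x))) refl x y ⟩
      (x + y) * (x * x * (y - x))           ≡⟨ cong (_* (x * x * (y - x))) rel ⟩
      P * (x * y) * (x * x * (y - x))       ≡⟨ solve 3 (λ P x y → P :* (x :* y) :* (x :* x :* (y :- x))
           := P :^ 1 :* (x :* x :* (x :* y) :* (y :- x))) refl P x y ⟩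
      P ^ 1 * (x * x * (x * y) * (y - x))   ∎
      where open ≡-Reasoning

    reflect-sum-square : x * x + y * y + ι 2 * (x * y) ≡ P * P * (x * y * (x * y))
    reflect-sum-square = begin
      x * x + y * y + ι 2 * (x * y)   ≡⟨ solve 2 (λ x y → x :* x :+ y :* y :+ :ι 2 :* (x :* y)
           := (x :+ y) :* (x :+ y)) refl x y ⟩
      (x + y) * (x + y)               ≡⟨ cong (λ z → z * z) rel ⟩
      P * (x * y) * (P * (x * y))     ≡⟨ solve 3 (λ P x y → P :* (x :* y) :* (P :* (x :* y))
           := P :* P :* (x :* y :* (x :* y))) refl P x y ⟩
      P * P * (x * y * (x * y))       ∎
      where open ≡-Reasoning

-- Index reflections modulo p = 2m + 1 and integrality of the reciprocals

module Congruences (𝓡 : RationalAlgebra) (m : ℕ) (𝓘 : PIntegral 𝓡 (suc (m ℕ.+ m)))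
  (p∤2 : ¬ suc (m ℕ.+ m) ∣ 2) (p∤15 : ¬ suc (m ℕ.+ m) ∣ 15) where
  open Base 𝓡
  open ExactSums 𝓡
  open Reflection 𝓡

  l p : ℕ
  l = m ℕ.+ m
  p = suc l

  open Divisible 𝓡 p 𝓘

  p∤3 : ¬ p ∣ 3
  p∤3 p∣3 = p∤15 (∣-trans p∣3 (divides 5 refl))

  -- Indices are one below the numbers they stand for: on a = i + 1 this is the reflection a ↦ p -
  -- a.
  r : ℕ → ℕ
  r i = l ℕ.∸ suc i

  π : Carrier
  π = u l

  -- v i = 1/(p-(i+1)), s i = 1/(p-2(i+1)), x k = 1/(p+(k+1)), y k = 1/(2p-(k+1)).
  v s x y : ℕ → Carrier
  v i = u (r i)
  s i = o (m ℕ.∸ suc i)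
  x k = u (l ℕ.+ suc k)
  y k = x (r k)

  Pπ : P * π ≡ 1#
  Pπ = ι-inv l

  m≤l : m ℕ.≤ l
  m≤l = ℕ.m≤m+n m m

  <m⇒<l : ∀ {i} → i ℕ.< m → i ℕ.< l
  <m⇒<l i<m = ℕ.<-≤-trans i<m m≤l

  r<l : ∀ {i} → i ℕ.< l → r i ℕ.< l
  r<l {i} i<l = ℕ.∸-monoʳ-< {l} {suc i} {0} (s≤s z≤n) i<l

  r-r : ∀ {i} → i ℕ.< l → r (r i) ≡ i
  r-r {i} i<l = trans (cong (l ℕ.∸_) (sym (ℕ.+-∸-assoc 1 i<l))) (ℕ.m∸[m∸n]≡n (ℕ.<⇒≤ i<l))

  +-r : ∀ {i} → i ℕ.< l → suc i ℕ.+ suc (r i) ≡ p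
  +-r {i} i<l = trans (ℕ.+-suc (suc i) (r i)) (cong suc (ℕ.m+[n∸m]≡n i<l))

  double< : ∀ {j} → j ℕ.< m → suc (j ℕ.+ j) ℕ.< l
  double< {j} j<m = ℕ.≤-trans (ℕ.≤-reflexive (cong suc (sym (ℕ.+-suc j j)))) (ℕ.+-mono-≤ j<m j<m)

  p∤small : ∀ {i} → i ℕ.< l → ¬ p ∣ suc i
  p∤small i<l = >⇒∤ (s≤s i<l)

  u-int : ∀ {i} → i ℕ.< l → Integral (u i)
  u-int i<l = inv-int (p∤small i<l)

  v-int : ∀ {i} → i ℕ.< l → Integral (v i)
  v-int i<l = u-int (r<l i<l)

  x-int : ∀ {i} → i ℕ.< l → Integral (x i)
  x-int {i} i<l = inv-int {suc (l ℕ.+ suc i)} (λ p∣ → p∤small i<l (∣m+n∣m⇒∣n p∣ ∣-refl))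

  y-int : ∀ {i} → i ℕ.< l → Integral (y i)
  y-int i<l = x-int (r<l i<l)

  o-int : ∀ {j} → j ℕ.< m → Integral (o j)
  o-int j<m = u-int (ℕ.<-trans (ℕ.n<1+n _) (double< j<m))

  t-int : ∀ {j} → j ℕ.< m → Integral (t j)
  t-int j<m = u-int (double< j<m)

  s-int : ∀ {j} → j ℕ.< m → Integral (s j)
  s-int {j} j<m = o-int (ℕ.∸-monoʳ-< {m} {suc j} {0} (s≤s z≤n) j<m)

  -- Beyond the critical index `m` the odd denominator is p + (2d+2). For d < m it lies strictly
  -- between p and 2p, so its reciprocal is integral again.
  o-upper : ∀ d → o (suc (m ℕ.+ d)) ≡ x (suc (d ℕ.+ d))
  o-upper d = cong inv (index m d)
    where
    index : ∀ m d → suc (suc (m ℕ.+ d) ℕ.+ suc (m ℕ.+ d)) ≡ suc (m ℕ.+ m ℕ.+ suc (suc (d ℕ.+ d)))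
    index = solve-∀

  o-upper-int : ∀ {d} → d ℕ.< m → Integral (o (suc (m ℕ.+ d)))
  o-upper-int {d} d<m = subst Integral (sym (o-upper d)) (x-int (double< d<m))

  uv : ∀ {i} → i ℕ.< l → u i + v i ≡ P * (u i * v i)
  uv {i} i<l = trans (inv-+ i (r i)) (cong (λ k → ι k * (u i * v i)) (+-r i<l))

  ts : ∀ {i} → i ℕ.< m → t i + s i ≡ P * (t i * s i)
  ts {i} i<m = trans (inv-+ (suc (i ℕ.+ i)) ((m ℕ.∸ suc i) ℕ.+ (m ℕ.∸ suc i)))
    (cong (λ k → ι k * (t i * s i)) (trans (index i (m ℕ.∸ suc i)) (cong (λ k → suc (k ℕ.+ k)) (ℕ.m+[n∸m]≡n i<m))))
    where
    index : ∀ i k → suc (suc (i ℕ.+ i)) ℕ.+ suc (k ℕ.+ k) ≡ suc ((suc i ℕ.+ k) ℕ.+ (suc i ℕ.+ k))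
    index = solve-∀

  xy : ∀ {i} → i ℕ.< l → x i + y i ≡ ι 3 * P * (x i * y i)
  xy {i} i<l = trans (inv-+ (l ℕ.+ suc i) (l ℕ.+ suc (r i)))
    (cong (_* (x i * y i)) (trans (cong ι (trans (index l (suc i) (suc (r i))) (trans (cong (2 ℕ.* p ℕ.+_) (+-r i<l)) (triple p)))) (ι-* 3 p)))
    where
    index : ∀ l a b → suc (l ℕ.+ a) ℕ.+ suc (l ℕ.+ b) ≡ 2 ℕ.* suc l ℕ.+ (a ℕ.+ b)
    index = solve-∀
    triple : ∀ p → 2 ℕ.* p ℕ.+ p ≡ 3 ℕ.* p
    triple = solve-∀

  sum-uv : ∀ (g : Carrier → Carrier) → sum l (λ i → g (u i)) ≡ sum m (λ i → g (u i)) + sum m (λ i → g (v i))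
  sum-uv g = trans (sum-fold m (λ i → g (u i))) (sum-+ m _ _)

  -- Because p is odd, the odd numbers below p are the reflections of the even ones.
  sum-st : ∀ (g : Carrier → Carrier) → sum l (λ i → g (u i)) ≡ sum m (λ i → g (s i)) + sum m (λ i → g (t i))
  sum-st g = trans (sum-parity m (λ i → g (u i))) (trans (sum-+ m (λ i → g (o i)) (λ i → g (t i)))
    (cong (_+ sum m (λ i → g (t i))) (sum-reverse m (λ i → g (o i)))))

  -- Power sums over the full range and over its lower half

  _² _⁴ : Carrier → Carrier
  a ² = a * a
  a ⁴ = a * a * (a * a)

  h₂ h₄ H₂ H₄ Q : Carrier
  h₂ = sum m (λ i → u i ²)
  h₄ = sum m (λ i → u i ⁴)
  H₂ = sum l (λ i → u i ²)
  H₄ = sum l (λ i → u i ⁴)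
  Q  = sum m (λ i → u i * v i)

  module _ {i : ℕ} (i<m : i ℕ.< m) where
    private
      i<l = <m⇒<l i<m

    uv-fourth : Div 1 (v i ⁴ - u i ⁴)
    uv-fourth = div _ (u-int i<l ⊗ v-int i<l ⊗ (v-int i<l ⊕ ⊝ u-int i<l) ⊗ (u-int i<l ⊗ u-int i<l ⊕ v-int i<l ⊗ v-int i<l))
      (reflect-fourth (uv i<l))

    st-fourth : Div 1 (s i ⁴ - t i ⁴)
    st-fourth = div _ (t-int i<m ⊗ s-int i<m ⊗ (s-int i<m ⊕ ⊝ t-int i<m) ⊗ (t-int i<m ⊗ t-int i<m ⊕ s-int i<m ⊗ s-int i<m))
      (reflect-fourth (ts i<m))

    uv-product : Div 1 (u i * v i * (u i * v i) - u i ⁴)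
    uv-product = div _ (u-int i<l ⊗ u-int i<l ⊗ (u-int i<l ⊗ v-int i<l) ⊗ (v-int i<l ⊕ ⊝ u-int i<l))
      (reflect-product (uv i<l))

    uv-square : Div 3 (v i ² - (u i ² + ι 2 * P * (u i * u i * u i) + ι 3 * P * P * (u i ⁴)))
    uv-square = div _ (v-int i<l ⊗ v-int i<l ⊗ (u-int i<l ⊗ u-int i<l ⊗ u-int i<l) ⊗ (ι-int 4 ⊕ ⊝ (ι-int 3 ⊗ P-int ⊗ u-int i<l)))
      (reflect-square (uv i<l))

    st-square : Div 3 (s i ² - (t i ² + ι 2 * P * (t i * t i * t i) + ι 3 * P * P * (t i ⁴)))
    st-square = div _ (s-int i<m ⊗ s-int i<m ⊗ (t-int i<m ⊗ t-int i<m ⊗ t-int i<m) ⊗ (ι-int 4 ⊕ ⊝ (ι-int 3 ⊗ P-int ⊗ t-int i<m)))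
      (reflect-square (ts i<m))

    -- The weights -8 and 8 make the two splittings of `H₄` cancel after summation. As `u i` is
    -- twice `t i`, the fourth powers left over combine to 16 - 1 = 15 times `u i ⁴`.
    fourth-combination : Div 1 (ι 15 * u i ⁴ + - ι 8 * (u i ⁴ + v i ⁴) + ι 8 * (s i ⁴ + t i ⁴))
    fourth-combination = Div-resp
      (trans
        (solve 4 (λ u v s t → :ι 8 :* (s :* s :* (s :* s) :- t :* t :* (t :* t)) :+ :- :ι 8 :* (v :* v :* (v :* v) :- u :* u :* (u :* u))
          := (:ι 16 :* (u :* u :* (u :* u)) :- (t :+ t) :* (t :+ t) :* ((t :+ t) :* (t :+ t)))
             :+ (:- :ι 8 :* (u :* u :* (u :* u) :+ v :* v :* (v :* v)) :+ :ι 8 :* (s :* s :* (s :* s) :+ t :* t :* (t :* t))))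
          refl (u i) (v i) (s i) (t i))
        (trans (cong (λ z → (ι 16 * u i ⁴ - z ⁴) + (- ι 8 * (u i ⁴ + v i ⁴) + ι 8 * (s i ⁴ + t i ⁴))) (sym (u≡t+t i)))
          (solve 3 (λ a b c → (:ι 16 :* a :- a) :+ (b :+ c) := :ι 15 :* a :+ b :+ c) refl (u i ⁴) _ _)))
      (Div-lin (ι-int 8) (⊝ ι-int 8) st-fourth uv-fourth)

    -- The weights 16 and -2 are in the ratio -8, which eliminates the cubes: 16 t³ = 2 u³ because
    -- `u i` is twice `t i`. Only squares and a fourth power with factor P² remain.
    square-combination : Div 3 (ι 16 * (s i ² + t i ²) + - ι 2 * (u i ² + v i ²) + 1# * (ι 3 * P * P * u i ⁴ - ι 4 * u i ²))
    square-combination = Div-resp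
      (trans
        (cong (λ z → ι 16 * (s i ² - A (t i)) + - ι 2 * (v i ² - A z)) (u≡t+t i))
        (trans
          (solve 4 (λ P v s t →
               :ι 16 :* (s :* s :- :A P t) :+ :- :ι 2 :* (v :* v :- :A P (t :+ t))
            := :ι 16 :* (s :* s :+ t :* t) :+ :- :ι 2 :* ((t :+ t) :* (t :+ t) :+ v :* v)
               :+ :1 :* (:ι 3 :* P :* P :* ((t :+ t) :* (t :+ t) :* ((t :+ t) :* (t :+ t))) :- :ι 4 :* ((t :+ t) :* (t :+ t))))
            refl P (v i) (s i) (t i))
          (cong (λ z → ι 16 * (s i ² + t i ²) + - ι 2 * (z ² + v i ²) + 1# * (ι 3 * P * P * z ⁴ - ι 4 * z ²)) (sym (u≡t+t i)))))
      (Div-lin (ι-int 16) (⊝ ι-int 2) st-square uv-square)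
      where
      A : Carrier → Carrier
      A z = z ² + ι 2 * P * (z * z * z) + ι 3 * P * P * (z ⁴)
      :A : ∀ {n} → Polynomial n → Polynomial n → Polynomial n
      :A P z = z :* z :+ :ι 2 :* P :* (z :* z :* z) :+ :ι 3 :* P :* P :* (z :* z :* (z :* z))

  -- Splitting Σ_{i<p} 1/i⁴ by i ↦ p - i gives 2h₄ modulo p, splitting it by parity gives h₄/8.
  h₄-div : Div 1 h₄
  h₄-div = Div-cancel 14 p∤15 (Div-resp eq (Div-sum m (λ i i<m → fourth-combination i<m)))
    where
    eq : sum m (λ i → ι 15 * u i ⁴ + - ι 8 * (u i ⁴ + v i ⁴) + ι 8 * (s i ⁴ + t i ⁴)) ≡ ι 15 * h₄
    eq = trans (sum-lin₃ m (ι 15) (- ι 8) (ι 8) (λ i → u i ⁴) (λ i → u i ⁴ + v i ⁴) (λ i → s i ⁴ + t i ⁴))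
      (trans (cong₂ (λ a b → ι 15 * h₄ + - ι 8 * a + ι 8 * b)
          (trans (sum-+ m _ _) (sym (sum-uv _⁴)))
          (trans (sum-+ m _ _) (sym (sum-st _⁴))))
        (solve 2 (λ a b → :ι 15 :* a :+ :- :ι 8 :* b :+ :ι 8 :* b := :ι 15 :* a) refl h₄ H₄))

  H₂-h₂ : Div 3 (ι 14 * H₂ - ι 4 * h₂)
  H₂-h₂ = Div-resp
    (trans (cong (_+ - ι 3 * (P ^ 2 * h₄)) eq)
      (solve 4 (λ P a b c → :ι 14 :* a :- :ι 4 :* b :+ :ι 3 :* P :* P :* c :+ :- :ι 3 :* (P :^ 2 :* c)
           := :ι 14 :* a :- :ι 4 :* b) refl P H₂ h₂ h₄))
    -- The leftover 3P²h₄ reaches p³ because `h₄` is itself divisible by p.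
    (Div-+ (Div-sum m (λ i i<m → square-combination i<m)) (Div-scale (⊝ ι-int 3) (Div-* (Div-P^ 2) h₄-div)))
    where
    eq : sum m (λ i → ι 16 * (s i ² + t i ²) + - ι 2 * (u i ² + v i ²) + 1# * (ι 3 * P * P * u i ⁴ - ι 4 * u i ²))
       ≡ ι 14 * H₂ - ι 4 * h₂ + ι 3 * P * P * h₄
    eq = trans (sum-lin₃ m (ι 16) (- ι 2) 1# (λ i → s i ² + t i ²) (λ i → u i ² + v i ²) (λ i → ι 3 * P * P * u i ⁴ - ι 4 * u i ²))
      (trans (cong₂ _+_ (cong₂ (λ a b → ι 16 * a + - ι 2 * b)
          (trans (sum-+ m _ _) (sym (sum-st _²)))
          (trans (sum-+ m _ _) (sym (sum-uv _²))))
          (cong (_*_ 1#) (trans (sum-cong m (λ i _ → solve 3 (λ P a b → :ι 3 :* P :* P :* a :- :ι 4 :* b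
               := :ι 3 :* P :* P :* a :+ :- :ι 4 :* b) refl P (u i ⁴) (u i ²)))
            (sum-lin₂ m (ι 3 * P * P) (- ι 4) (λ i → u i ⁴) (λ i → u i ²)))))
        (solve 4 (λ P a b c → :ι 16 :* a :+ :- :ι 2 :* a :+ :1 :* (:ι 3 :* P :* P :* c :+ :- :ι 4 :* b)
          := :ι 14 :* a :- :ι 4 :* b :+ :ι 3 :* P :* P :* c) refl P H₂ h₂ h₄))

  M : Carrier
  M = sum m (λ i → u i * v i * (u i * v i))

  M-div : Div 1 M
  M-div = Div-resp eq (Div-+ (Div-sum m (λ i i<m → uv-product i<m)) h₄-div)
    where
    eq : sum m (λ i → u i * v i * (u i * v i) - u i ⁴) + h₄ ≡ M
    eq = trans (sym (sum-+ m _ _)) (sum-cong m (λ i _ → solve 2 (λ a b → a :- b :+ b := a) refl _ _))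

  H₂+2Q : H₂ + ι 2 * Q ≡ P ^ 2 * M
  H₂+2Q = begin
    H₂ + ι 2 * Q
      ≡⟨ cong₂ _+_ (trans (sum-uv _²) (sym (sum-+ m _ _))) (sym (sum-* m (ι 2) _)) ⟩
    sum m (λ i → u i ² + v i ²) + sum m (λ i → ι 2 * (u i * v i))
      ≡⟨ sym (sum-+ m _ _) ⟩
    sum m (λ i → u i ² + v i ² + ι 2 * (u i * v i))
      ≡⟨ sum-cong m (λ i i<m → reflect-sum-square (uv (<m⇒<l i<m))) ⟩
    sum m (λ i → P * P * (u i * v i * (u i * v i)))
      ≡⟨ sum-* m (P * P) _ ⟩
    P * P * M
      ≡⟨ solve 2 (λ P M → P :* P :* M := P :^ 2 :* M) refl P M ⟩
    P ^ 2 * M ∎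
    where open ≡-Reasoning

  H₂+2Q-div : Div 3 (H₂ + ι 2 * Q)
  H₂+2Q-div = Div-resp (sym H₂+2Q) (Div-* (Div-P^ 2) M-div)

  uv-sq-div : ∀ {i} → i ℕ.< m → Div 1 (v i ² - u i ²)
  uv-sq-div {i} i<m = div (u i * v i * (v i - u i)) (u-int i<l ⊗ v-int i<l ⊗ (v-int i<l ⊕ ⊝ u-int i<l))
    (trans (solve 2 (λ u v → v :* v :- u :* u := (u :+ v) :* (v :- u)) refl (u i) (v i))
      (trans (cong (_* (v i - u i)) (uv i<l))
        (solve 3 (λ P u v → P :* (u :* v) :* (v :- u) := P :^ 1 :* (u :* v :* (v :- u))) refl P (u i) (v i))))
    where i<l = <m⇒<l i<m

  H₂-2h₂ : Div 1 (H₂ - ι 2 * h₂)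
  H₂-2h₂ = Div-resp eq (Div-sum m (λ i i<m → uv-sq-div i<m))
    where
    eq : sum m (λ i → v i ² - u i ²) ≡ H₂ - ι 2 * h₂
    eq = trans (solve 2 (λ a b → a := a :+ b :- b) refl _ h₂)
      (trans (cong (_- h₂) (trans (sym (sum-+ m _ _)) (sum-cong m (λ i _ → solve 2 (λ u v → v :- u :+ u
           := v) refl (u i ²) (v i ²)))))
        (trans (solve 2 (λ h v → v :- h := h :+ v :- :ι 2 :* h) refl h₂ (sum m (λ i → v i ²)))
          (cong (_- ι 2 * h₂) (sym (sum-uv _²)))))

  -- Modulo p both 14H₂ ≡ 4h₂ and H₂ ≡ 2h₂ hold; eliminating `H₂` leaves 24h₂ ≡ 0, and 24 = 2 · 2 ·
  -- 2 · 3 is cancelled factor by factor.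
  h₂-div : Div 1 h₂
  h₂-div = Div-cancel 1 p∤2 (Div-cancel 1 p∤2 (Div-cancel 1 p∤2 (Div-cancel 2 p∤3
    (Div-resp (solve 2 (λ a b → :1 :* (:ι 14 :* a :- :ι 4 :* b) :+ :- :ι 14 :* (a :- :ι 2 :* b)
                := :ι 3 :* (:ι 2 :* (:ι 2 :* (:ι 2 :* b)))) refl H₂ h₂)
      (Div-lin 1-int (⊝ ι-int 14) (Div-pred (Div-pred H₂-h₂)) H₂-2h₂)))))

  H₂-div : Div 1 H₂
  H₂-div = Div-resp (solve 2 (λ a b → a :- :ι 2 :* b :+ :ι 2 :* b := a) refl H₂ h₂)
    (Div-+ H₂-2h₂ (Div-scale (ι-int 2) h₂-div))

  Q-div : Div 1 Q
  Q-div = Div-cancel 1 p∤2 (Div-resp (solve 2 (λ a b → :1 :* (a :+ :ι 2 :* b) :+ :- :1 :* a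
       := :ι 2 :* b) refl H₂ Q)
    (Div-lin 1-int (⊝ 1-int) (Div-pred (Div-pred H₂+2Q-div)) H₂-div))

  H≡PQ : H l ≡ P * Q
  H≡PQ = trans (sum-uv (λ a → a)) (trans (sym (sum-+ m u v))
    (trans (sum-cong m (λ i i<m → uv (<m⇒<l i<m))) (sum-* m P _)))

  -- Reciprocals of the numbers between p and 2p

  N L K : Carrier
  N = sum m (λ i → x i * y i)
  L = sum m (λ i → x i * y i * (u i * v i))
  K = sum m (λ i → x i * y i * (x i * y i))

  module _ {i : ℕ} (i<m : i ℕ.< m) where
    private
      i<l = <m⇒<l i<m
      a = ι (suc i)
      b = ι (suc (r i))

    -- With a + b = P the denominators satisfy (P + a)(P + b) = ab + 2P², so moving both by P
    -- changes the product of reciprocals only to second order.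
    xy-uv : x i * y i ≡ u i * v i + - ι 2 * P * P * (x i * y i * (u i * v i))
    xy-uv = begin
      x i * y i                                        ≡⟨ solve 1 (λ z → z := z :* :1 :* :1) refl _ ⟩
      x i * y i * 1# * 1#                              ≡⟨ cong₂ (λ α β → x i * y i * α * β) (sym (ι-inv i)) (sym (ι-inv (r i))) ⟩
      x i * y i * (a * u i) * (b * v i)
        ≡⟨ solve 7 (λ P a b x y u v → x :* y :* (a :* u) :* (b :* v)
             := u :* v :* ((P :+ a) :* x) :* ((P :+ b) :* y) :- P :* (P :+ (a :+ b)) :* (x :* y :* (u :* v)))
             refl P a b (x i) (y i) (u i) (v i) ⟩
      u i * v i * ((P + a) * x i) * ((P + b) * y i) - P * (P + (a + b)) * (x i * y i * (u i * v i))
        ≡⟨ cong₂ (λ α β → u i * v i * α * β - P * (P + (a + b)) * (x i * y i * (u i * v i))) (shifted i) (shifted (r i)) ⟩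
      u i * v i * 1# * 1# - P * (P + (a + b)) * (x i * y i * (u i * v i))
        ≡⟨ cong (λ z → u i * v i * 1# * 1# - P * (P + z) * (x i * y i * (u i * v i))) (trans (sym (ι-+ (suc i) (suc (r i)))) (cong ι (+-r i<l))) ⟩
      u i * v i * 1# * 1# - P * (P + P) * (x i * y i * (u i * v i))
        ≡⟨ solve 3 (λ P a b → a :* :1 :* :1 :- P :* (P :+ P) :* b := a :+ :- :ι 2 :* P :* P :* b) refl P _ _ ⟩
      u i * v i + - ι 2 * P * P * (x i * y i * (u i * v i)) ∎
      where
      open ≡-Reasoning
      shifted : ∀ k → (P + ι (suc k)) * x k ≡ 1#
      shifted k = trans (cong (_* x k) (sym (ι-+ p (suc k)))) (ι-inv (l ℕ.+ suc k))

    xyuv-div : Div 2 (x i * y i * (u i * v i) - u i * v i * (u i * v i))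
    xyuv-div = div (- ι 2 * (x i * y i * (u i * v i) * (u i * v i)))
      (⊝ ι-int 2 ⊗ (x-int i<l ⊗ y-int i<l ⊗ (u-int i<l ⊗ v-int i<l) ⊗ (u-int i<l ⊗ v-int i<l)))
      (trans (cong (λ z → z * (u i * v i) - u i * v i * (u i * v i)) xy-uv)
        (solve 3 (λ P w z → (w :+ :- :ι 2 :* P :* P :* z) :* w :- w :* w
             := P :^ 2 :* (:- :ι 2 :* (z :* w))) refl P (u i * v i) _))

    xyxy-div : Div 2 (x i * y i * (x i * y i) - x i * y i * (u i * v i))
    xyxy-div = div (- ι 2 * (x i * y i * (u i * v i) * (x i * y i)))
      (⊝ ι-int 2 ⊗ (x-int i<l ⊗ y-int i<l ⊗ (u-int i<l ⊗ v-int i<l) ⊗ (x-int i<l ⊗ y-int i<l)))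
      (trans (cong (λ z → x i * y i * z - x i * y i * (u i * v i)) xy-uv)
        (solve 4 (λ P q w z → q :* (w :+ :- :ι 2 :* P :* P :* z) :- q :* w
             := P :^ 2 :* (:- :ι 2 :* (z :* q))) refl P (x i * y i) (u i * v i) (x i * y i * (u i * v i))))

  Div-sum-≈ : ∀ {k} f g → (∀ i → i ℕ.< m → Div k (f i - g i)) → Div k (sum m g) → Div k (sum m f)
  Div-sum-≈ f g h d = Div-resp
    (trans (sym (sum-+ m _ g)) (sum-cong m (λ i _ → solve 2 (λ a b → a :- b :+ b := a) refl (f i) (g i))))
    (Div-+ (Div-sum m h) d)

  L-div : Div 1 L
  L-div = Div-sum-≈ _ _ (λ i i<m → Div-pred (xyuv-div i<m)) M-div

  K-div : Div 1 K
  K-div = Div-sum-≈ _ _ (λ i i<m → Div-pred (xyxy-div i<m)) L-div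

  N-Q : N ≡ Q + - ι 2 * P * P * L
  N-Q = trans (sum-cong m (λ i i<m → xy-uv i<m)) (trans (sum-+ m _ _) (cong (_+_ Q) (sum-* m (- ι 2 * P * P) _)))

  N-Q-div : Div 3 (N - Q)
  N-Q-div = Div-resp
    (trans (solve 3 (λ P Q L → :- :ι 2 :* (P :^ 2 :* L)
         := Q :+ :- :ι 2 :* P :* P :* L :- Q) refl P Q L) (cong (_- Q) (sym N-Q)))
    (Div-scale (⊝ ι-int 2) (Div-* (Div-P^ 2) L-div))

  X₁ X₂ : Carrier
  X₁ = sum l x
  X₂ = sum l (λ i → x i ²)

  X₁≡ : X₁ ≡ ι 3 * P * N
  X₁≡ = trans (sum-fold m x) (trans (sum-cong m (λ i i<m → xy (<m⇒<l i<m))) (sum-* m (ι 3 * P) _))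

  X₂≡ : X₂ ≡ ι 9 * P * P * K + - ι 2 * N
  X₂≡ = trans (sum-fold m (λ i → x i ²)) (trans (sum-cong m (λ i i<m → begin
      x i ² + y i ²                                     ≡⟨ solve 2 (λ x y → x :* x :+ y :* y
           := (x :+ y) :* (x :+ y) :+ :- :ι 2 :* (x :* y)) refl (x i) (y i) ⟩
      (x i + y i) ² + - ι 2 * (x i * y i)               ≡⟨ cong (λ z → z ² + - ι 2 * (x i * y i)) (xy (<m⇒<l i<m)) ⟩
      (ι 3 * P * (x i * y i)) ² + - ι 2 * (x i * y i)   ≡⟨ solve 2 (λ P w → :ι 3 :* P :* w :* (:ι 3 :* P :* w) :+ :- :ι 2 :* w
           := :ι 9 :* P :* P :* (w :* w) :+ :- :ι 2 :* w) refl P (x i * y i) ⟩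
      ι 9 * P * P * (x i * y i * (x i * y i)) + - ι 2 * (x i * y i) ∎))
    (sum-lin₂ m (ι 9 * P * P) (- ι 2) _ _))
    where open ≡-Reasoning

  X₂+2Q-div : Div 3 (X₂ + ι 2 * Q)
  X₂+2Q-div = Div-resp
    (trans (solve 4 (λ P K N Q → :ι 9 :* (P :^ 2 :* K) :+ :- :ι 2 :* (N :- Q)
         := :ι 9 :* P :* P :* K :+ :- :ι 2 :* N :+ :ι 2 :* Q) refl P K N Q)
      (cong (_+ ι 2 * Q) (sym X₂≡)))
    (Div-lin (ι-int 9) (⊝ ι-int 2) (Div-* (Div-P^ 2) K-div) N-Q-div)

  -- Harmonic sums up to 2p - 1 and the values of O and C + D

  sum-to-2p-1 : ∀ (g : Carrier → Carrier) → sum (suc (l ℕ.+ l)) (λ i → g (u i)) ≡ sum l (λ i → g (u i)) + (g π + sum l (λ i → g (x i)))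
  sum-to-2p-1 g = begin
    sum (suc (l ℕ.+ l)) (λ i → g (u i))                          ≡⟨ cong (λ k → sum k (λ i → g (u i))) (sym (ℕ.+-suc l l)) ⟩
    sum (l ℕ.+ suc l) (λ i → g (u i))                            ≡⟨ sum-split l (suc l) _ ⟩
    sum l (λ i → g (u i)) + sum (suc l) (λ i → g (u (l ℕ.+ i)))  ≡⟨ cong (_+_ _) (sum-head l _) ⟩
    sum l (λ i → g (u i)) + (g (u (l ℕ.+ 0)) + sum l (λ i → g (x i)))
      ≡⟨ cong (λ k → sum l (λ i → g (u i)) + (g (u k) + sum l (λ i → g (x i)))) (ℕ.+-identityʳ l) ⟩
    sum l (λ i → g (u i)) + (g π + sum l (λ i → g (x i)))        ∎
    where open ≡-Reasoning

  -- `O p` is H_{2p-1} without its even part H_{p-1}/2. Here H_{2p-1} equals PQ + π + 3PN, and N ≡ Q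
  -- (mod p³) gains a fourth factor p from P.
  O-div : Div 4 (ι 2 * O p - ι 2 * π - ι 7 * P * Q)
  O-div = Div-resp (trans
      (solve 4 (λ P Q N π → :ι 6 :* (P :^ 1 :* (N :- Q))
           := :ι 2 :* (P :* Q :+ (π :+ :ι 3 :* P :* N)) :- P :* Q :- :ι 2 :* π :- :ι 7 :* P :* Q)
           refl P Q N π)
      (cong (λ z → z - ι 2 * π - ι 7 * P * Q) (sym eq)))
    (Div-scale (ι-int 6) (Div-* (Div-P^ 1) N-Q-div))
    where
    open ≡-Reasoning
    eq : ι 2 * O p ≡ ι 2 * (P * Q + (π + ι 3 * P * N)) - P * Q
    eq = begin
      ι 2 * O p                                 ≡⟨ solve 2 (λ o t → :ι 2 :* o
           := :ι 2 :* (o :+ t) :- (t :+ t)) refl (O p) (T l) ⟩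
      ι 2 * (O p + T l) - (T l + T l)           ≡⟨ cong₂ (λ a b → ι 2 * a - b) (sym (H-odd l)) (sym (H≡T+T l)) ⟩
      ι 2 * H (suc (l ℕ.+ l)) - H l             ≡⟨ cong (λ z → ι 2 * z - H l) (sum-to-2p-1 (λ a → a)) ⟩
      ι 2 * (H l + (π + X₁)) - H l              ≡⟨ cong₂ (λ a b → ι 2 * (a + (π + b)) - a) H≡PQ X₁≡ ⟩
      ι 2 * (P * Q + (π + ι 3 * P * N)) - P * Q ∎

  N-div : Div 1 N
  N-div = Div-resp (solve 2 (λ a b → a :- b :+ b := a) refl N Q) (Div-+ (Div-pred (Div-pred N-Q-div)) Q-div)

  CD : Carrier
  CD = C l + D l

  -- Modulo p³ the squares in `Fu` and `Ft` disappear, and N ≡ Q while `H₂` and `X₂` are both ≡ -2Q.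
  -- With z ≡ 4Q this gives 4(8 + 2 + 2) - 2 = 46.
  CD-div : Div 3 (ι 4 * CD - ι 46 * Q)
  CD-div = Div-resp (sym eq)
    (Div-+ (Div-+ (Div-scale (ι-int 24) N-Q-div) (Div-lin (⊝ ι-int 3) (⊝ ι-int 4) H₂+2Q-div X₂+2Q-div))
           (Div-pred (Div-* (Div-P^ 2) (Div-lin (ι-int 4) (⊝ 1-int) (Div-* dz dz) (Div-* Q-div Q-div)))))
    where
    open ≡-Reasoning
    z = Q + ι 3 * N
    dz : Div 1 z
    dz = Div-+ Q-div (Div-scale (ι-int 3) N-div)
    Fu : F u (suc (l ℕ.+ l)) ≡ P * P * z ² + ι 2 * z - H₂ - X₂
    Fu = begin
      F u (suc (l ℕ.+ l))
        ≡⟨ cong₂ (λ a b → a * a - b) (sum-to-2p-1 (λ a → a)) (sum-to-2p-1 _²) ⟩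
      (H l + (π + X₁)) ² - (H₂ + (π ² + X₂))
        ≡⟨ cong₂ (λ a b → (a + (π + b)) ² - (H₂ + (π ² + X₂))) H≡PQ X₁≡ ⟩
      (P * Q + (π + ι 3 * P * N)) ² - (H₂ + (π ² + X₂))
        -- The 1/p² in the square cancels the one in the sum of squares; of the non-integral parts
        -- only the cross term 2(Pπ)z = 2z survives.
        ≡⟨ solve 6 (λ P π Q N H X → (P :* Q :+ (π :+ :ι 3 :* P :* N)) :* (P :* Q :+ (π :+ :ι 3 :* P :* N)) :- (H :+ (π :* π :+ X))
            := P :* P :* ((Q :+ :ι 3 :* N) :* (Q :+ :ι 3 :* N)) :+ :ι 2 :* (P :* π) :* (Q :+ :ι 3 :* N) :- H :- X)
            refl P π Q N H₂ X₂ ⟩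
      P * P * z ² + ι 2 * (P * π) * z - H₂ - X₂
        ≡⟨ cong (λ w → P * P * z ² + ι 2 * w * z - H₂ - X₂) Pπ ⟩
      P * P * z ² + ι 2 * 1# * z - H₂ - X₂
        ≡⟨ solve 4 (λ a z H X → a :+ :ι 2 :* :1 :* z :- H :- X := a :+ :ι 2 :* z :- H :- X) refl _ z H₂ X₂ ⟩
      P * P * z ² + ι 2 * z - H₂ - X₂ ∎
    Ft : ι 4 * F t l ≡ P * P * Q ² - H₂
    Ft = begin
      ι 4 * (T l ² - sum l (λ i → t i ²))           ≡⟨ solve 2 (λ a b → :ι 4 :* (a :* a :- b)
           := (a :+ a) :* (a :+ a) :- :ι 4 :* b) refl (T l) _ ⟩
      (T l + T l) ² - ι 4 * sum l (λ i → t i ²)     ≡⟨ cong₂ (λ a b → a ² - b) (trans (sym (H≡T+T l)) H≡PQ)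
           (trans (sym (sum-* l (ι 4) _)) (sum-cong l (λ i _ → trans (solve 1 (λ t → :ι 4 :* (t :* t)
                := (t :+ t) :* (t :+ t)) refl (t i)) (cong _² (sym (u≡t+t i)))))) ⟩
      (P * Q) ² - H₂                                ≡⟨ solve 3 (λ P Q H → P :* Q :* (P :* Q) :- H
           := P :* P :* (Q :* Q) :- H) refl P Q H₂ ⟩
      P * P * Q ² - H₂                              ∎
    eq : ι 4 * CD - ι 46 * Q ≡ ι 24 * (N - Q) + (- ι 3 * (H₂ + ι 2 * Q) + - ι 4 * (X₂ + ι 2 * Q)) + P ^ 2 * (ι 4 * z ² + - 1# * Q ²)
    eq = begin
      ι 4 * CD - ι 46 * Q
        ≡⟨ cong (λ w → ι 4 * w - ι 46 * Q) (C+D l) ⟩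
      ι 4 * (F u (suc (l ℕ.+ l)) - F t l) - ι 46 * Q
        ≡⟨ solve 3 (λ a b Q → :ι 4 :* (a :- b) :- :ι 46 :* Q
             := :ι 4 :* a :- :ι 4 :* b :- :ι 46 :* Q) refl _ (F t l) Q ⟩
      ι 4 * F u (suc (l ℕ.+ l)) - ι 4 * F t l - ι 46 * Q
        ≡⟨ cong₂ (λ a b → ι 4 * a - b - ι 46 * Q) Fu Ft ⟩
      ι 4 * (P * P * z ² + ι 2 * z - H₂ - X₂) - (P * P * Q ² - H₂) - ι 46 * Q
        ≡⟨ solve 5 (λ P Q N H X → :ι 4 :* (P :* P :* ((Q :+ :ι 3 :* N) :* (Q :+ :ι 3 :* N)) :+ :ι 2 :* (Q :+ :ι 3 :* N) :- H :- X) :- (P :* P :* (Q :* Q) :- H) :- :ι 46 :* Q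
             := :ι 24 :* (N :- Q) :+ (:- :ι 3 :* (H :+ :ι 2 :* Q) :+ :- :ι 4 :* (X :+ :ι 2 :* Q)) :+ P :^ 2 :* (:ι 4 :* ((Q :+ :ι 3 :* N) :* (Q :+ :ι 3 :* N)) :+ :- :1 :* (Q :* Q)))
             refl P Q N H₂ X₂ ⟩
      ι 24 * (N - Q) + (- ι 3 * (H₂ + ι 2 * Q) + - ι 4 * (X₂ + ι 2 * Q)) + P ^ 2 * (ι 4 * z ² + - 1# * Q ²) ∎

  -- The odd numbers from 2e+1 to 2(m+d)+1 are symmetric about p. The middle one contributes π, and
  -- the reciprocals of each other pair, whose sum is 2p, cancel modulo p.
  O-reflect : ∀ d e → d ℕ.+ e ≡ m → Div 1 (O (suc (m ℕ.+ d)) - O e - π)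
  O-reflect zero e refl = div 0# 0-int
    (trans (cong₂ (λ a b → a + b - O m - π) (cong O (ℕ.+-identityʳ m)) (cong o (ℕ.+-identityʳ m)))
      (solve 3 (λ a b P → a :+ b :- a :- b := P :^ 1 :* :0) refl (O m) π P))
  O-reflect (suc d) e d+e≡m = Div-resp eq (Div-+ (O-reflect d (suc e) (trans (ℕ.+-suc d e) d+e≡m))
    (div (ι 2 * (o e * o k)) (ι-int 2 ⊗ (o-int e<m ⊗ o-upper-int d<m)) refl))
    where
    k = suc (m ℕ.+ d)
    e<m : e ℕ.< m
    e<m = ℕ.≤-trans (ℕ.m≤n+m (suc e) d) (ℕ.≤-reflexive (trans (ℕ.+-suc d e) d+e≡m))
    d<m : d ℕ.< m
    d<m = ℕ.≤-trans (ℕ.m≤m+n (suc d) e) (ℕ.≤-reflexive d+e≡m)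
    index : ∀ m d e → suc (e ℕ.+ e) ℕ.+ suc (suc (m ℕ.+ d) ℕ.+ suc (m ℕ.+ d)) ≡ 2 ℕ.* suc (m ℕ.+ (suc d ℕ.+ e))
    index = solve-∀
    pair : o e + o k ≡ ι 2 * P * (o e * o k)
    pair = trans (inv-+ (e ℕ.+ e) (k ℕ.+ k)) (cong (_* (o e * o k))
      (trans (cong ι (trans (index m d e) (cong (λ n → 2 ℕ.* suc (m ℕ.+ n)) d+e≡m))) (ι-* 2 p)))
    eq : O k - (O e + o e) - π + P ^ 1 * (ι 2 * (o e * o k)) ≡ O (suc (m ℕ.+ suc d)) - O e - π
    eq = begin
      O k - (O e + o e) - π + P ^ 1 * (ι 2 * (o e * o k))
        ≡⟨ solve 6 (λ A B x z π P → A :- (B :+ x) :- π :+ P :^ 1 :* (:ι 2 :* z)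
             := A :- (B :+ x) :- π :+ :ι 2 :* P :* z) refl (O k) (O e) (o e) (o e * o k) π P ⟩
      O k - (O e + o e) - π + ι 2 * P * (o e * o k)
        ≡⟨ cong (_+_ (O k - (O e + o e) - π)) (sym pair) ⟩
      O k - (O e + o e) - π + (o e + o k)
        ≡⟨ solve 5 (λ A B x y π → A :- (B :+ x) :- π :+ (x :+ y)
             := A :+ y :- B :- π) refl (O k) (O e) (o e) (o k) π ⟩
      O (suc k) - O e - π
        ≡⟨ cong (λ n → O (suc n) - O e - π) (sym (ℕ.+-suc m d)) ⟩
      O (suc (m ℕ.+ suc d)) - O e - π ∎
      where open ≡-Reasoning

  PO-div : Div 2 (P * O p - 1#)
  PO-div = Div-resp (trans
      (solve 3 (λ P O π → P :^ 1 :* (O :- :0 :- π) := P :* O :- P :* π) refl P (O p) π)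
      (cong (λ z → P * O p - z) Pπ))
    (Div-* (Div-P^ 1) (O-reflect m 0 (ℕ.+-identityʳ m)))

  O-int : ∀ {i} → i ℕ.≤ m → Integral (O i)
  O-int i≤m = sum-int _ (λ j j<i → o-int (ℕ.<-≤-trans j<i i≤m))

  -- The double sum X

  X R UV Y Y′ : Carrier
  X  = sum p (λ j → o j * sum j (λ i → u i ²))
  R  = sum l (λ i → O (suc i) * u i ²)
  UV = sum l (λ i → O (suc i) * (u i * v i))
  Y  = sum l (λ i → O (suc i) * (u i ² * v i))
  Y′ = sum m (λ i → u i * v i ²)

  P*UV : P * UV ≡ CD
  P*UV = trans (sym (sum-* l P _)) (trans (sum-cong l (λ i i<l → begin
      P * (O (suc i) * (u i * v i))    ≡⟨ solve 4 (λ P O u v → P :* (O :* (u :* v))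
           := O :* (P :* (u :* v))) refl P (O (suc i)) (u i) (v i) ⟩
      O (suc i) * (P * (u i * v i))    ≡⟨ cong (_*_ (O (suc i))) (sym (uv i<l)) ⟩
      O (suc i) * (u i + v i)          ≡⟨ solve 3 (λ O u v → O :* (u :+ v)
           := O :* v :+ O :* u) refl (O (suc i)) (u i) (v i) ⟩
      O (suc i) * v i + O (suc i) * u i ∎)) (sum-+ l _ _))
    where open ≡-Reasoning

  -- From u + v = Puv follows u² = Pu²v - uv. This trades `R`, which has no reflection symmetry, for
  -- `UV`, known through `C+D`, and for `P * Y`, which carries a factor P² in `X≡` and so is needed
  -- only modulo p².
  P*Y : P * Y ≡ R + UV
  P*Y = trans (sym (sum-* l P _)) (trans (sum-cong l (λ i i<l → begin
      P * (O (suc i) * (u i ² * v i))    ≡⟨ solve 4 (λ P O u v → P :* (O :* (u :* u :* v))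
           := O :* u :* (P :* (u :* v))) refl P (O (suc i)) (u i) (v i) ⟩
      O (suc i) * u i * (P * (u i * v i))    ≡⟨ cong (_*_ (O (suc i) * u i)) (sym (uv i<l)) ⟩
      O (suc i) * u i * (u i + v i)          ≡⟨ solve 3 (λ O u v → O :* u :* (u :+ v)
           := O :* (u :* u) :+ O :* (u :* v)) refl (O (suc i)) (u i) (v i) ⟩
      O (suc i) * u i ² + O (suc i) * (u i * v i) ∎)) (sum-+ l _ _))
    where open ≡-Reasoning

  P*Y′ : P * Y′ ≡ H₂ - h₂ + Q
  P*Y′ = begin
    P * Y′                               ≡⟨ sym (sum-* m P _) ⟩
    sum m (λ i → P * (u i * v i ²))      ≡⟨ sum-cong m (λ i i<m → trans (solve 3 (λ P u v → P :* (u :* (v :* v))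
         := P :* (u :* v) :* v) refl P (u i) (v i))
                                              (trans (cong (_* v i) (sym (uv (<m⇒<l i<m)))) (solve 2 (λ u v → (u :+ v) :* v
                                                   := v :* v :+ u :* v) refl (u i) (v i)))) ⟩
    sum m (λ i → v i ² + u i * v i)      ≡⟨ sum-+ m _ _ ⟩
    sum m (λ i → v i ²) + Q              ≡⟨ solve 3 (λ v h Q → v :+ Q := h :+ v :- h :+ Q) refl _ h₂ Q ⟩
    h₂ + sum m (λ i → v i ²) - h₂ + Q    ≡⟨ cong (λ z → z - h₂ + Q) (sym (sum-uv _²)) ⟩
    H₂ - h₂ + Q                          ∎
    where open ≡-Reasoning

  -- By `O-reflect` the values of O at i and p - i differ by π modulo p. The common value multiplies
  -- uv(u + v) and, with the outer P, yields p²; only π leaves a main term, Pπ · uv² = uv².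
  Y-term : ∀ {i} → i ℕ.< m → Div 2 (P * (O (suc i) * (u i ² * v i) + O (suc (r i)) * (v i ² * u (r (r i)))) + - 1# * (u i * v i ²))
  Y-term {i} i<m with subst (λ k → Div 1 (O (suc k) - O (suc i) - π)) (sym (ℕ.+-∸-assoc m i<m))
                        (O-reflect (m ℕ.∸ suc i) (suc i) (ℕ.m∸n+n≡m i<m))
  ... | div c ic e = div (a * (u i * v i) ² + c * (v i ² * u i))
    (O-int i<m ⊗ ((u-int i<l ⊗ v-int i<l) ⊗ (u-int i<l ⊗ v-int i<l)) ⊕ ic ⊗ (v-int i<l ⊗ v-int i<l ⊗ u-int i<l)) (begin
      P * (a * (u i ² * v i) + O (suc (r i)) * (v i ² * u (r (r i)))) + - 1# * (u i * v i ²)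
        ≡⟨ cong₂ (λ y k → P * (a * (u i ² * v i) + y * (v i ² * u k)) + - 1# * (u i * v i ²)) b≡ (r-r i<l) ⟩
      P * (a * (u i ² * v i) + (a + π + P ^ 1 * c) * (v i ² * u i)) + - 1# * (u i * v i ²)
        ≡⟨ solve 6 (λ P π a c u v → P :* (a :* (u :* u :* v) :+ (a :+ π :+ P :^ 1 :* c) :* (v :* v :* u)) :+ :- :1 :* (u :* (v :* v))
             := P :* a :* (u :* v) :* (u :+ v) :+ (P :* π) :* (u :* (v :* v)) :- u :* (v :* v) :+ P :* P :* (c :* (v :* v :* u)))
             refl P π a c (u i) (v i) ⟩
      P * a * (u i * v i) * (u i + v i) + (P * π) * (u i * v i ²) - u i * v i ² + P * P * (c * (v i ² * u i))
        ≡⟨ cong₂ (λ y z → P * a * (u i * v i) * y + z * (u i * v i ²) - u i * v i ² + P * P * (c * (v i ² * u i))) (uv i<l) Pπ ⟩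
      P * a * (u i * v i) * (P * (u i * v i)) + 1# * (u i * v i ²) - u i * v i ² + P * P * (c * (v i ² * u i))
        ≡⟨ solve 5 (λ P a w z c → P :* a :* w :* (P :* w) :+ :1 :* z :- z :+ P :* P :* c
             := P :^ 2 :* (a :* (w :* w) :+ c)) refl P a (u i * v i) (u i * v i ²) (c * (v i ² * u i)) ⟩
      P ^ 2 * (a * (u i * v i) ² + c * (v i ² * u i)) ∎)
    where
    open ≡-Reasoning
    i<l = <m⇒<l i<m
    a = O (suc i)
    b≡ : O (suc (r i)) ≡ a + π + P ^ 1 * c
    b≡ = trans (solve 3 (λ b a π → b
         := a :+ π :+ (b :- a :- π)) refl (O (suc (r i))) a π) (cong (_+_ (a + π)) e)

  Y-div : Div 2 (P * Y - Y′)
  Y-div = Div-resp eq (Div-sum m (λ i i<m → Y-term i<m))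
    where
    eq : sum m (λ i → P * (O (suc i) * (u i ² * v i) + O (suc (r i)) * (v i ² * u (r (r i)))) + - 1# * (u i * v i ²)) ≡ P * Y - Y′
    eq = trans (sum-lin₂ m P (- 1#) _ _)
      (trans (cong (λ z → P * z + - 1# * Y′) (sym (sum-fold m (λ i → O (suc i) * (u i ² * v i)))))
        (solve 3 (λ P Y Z → P :* Y :+ :- :1 :* Z := P :* Y :- Z) refl P Y Y′))

  X≡ : P * P * X ≡ P * H₂ * (P * O p) - P * P * (P * Y) + P * CD
  X≡ = begin
    P * P * X                                     ≡⟨ solve 3 (λ P X R → P :* P :* X
         := P :* P :* ((X :+ R) :- R)) refl P X R ⟩
    P * P * ((X + R) - R)                         ≡⟨ cong (λ z → P * P * (z - R)) (abel (λ i → u i ²) l) ⟩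
    P * P * (H₂ * O p - R)                        ≡⟨ solve 5 (λ P H O R U → P :* P :* (H :* O :- R)
         := P :* H :* (P :* O) :- P :* P :* (R :+ U) :+ P :* (P :* U)) refl P H₂ (O p) R UV ⟩
    P * H₂ * (P * O p) - P * P * (R + UV) + P * (P * UV)  ≡⟨ cong₂ (λ a b → P * H₂ * (P * O p) - P * P * a + P * b) (sym P*Y) P*UV ⟩
    P * H₂ * (P * O p) - P * P * (P * Y) + P * CD ∎
    where open ≡-Reasoning

  -- The three terms of `X≡` contribute -2, -6 and 23/2 times PQ: the first by PO ≡ 1 and H₂ ≡ -2Q,
  -- the second by PY ≡ Y′ and PY′ = H₂ - h₂ + Q ≡ 6Q, the third by `CD-div`.
  X-div : Div 4 (ι 2 * P * P * X - ι 7 * P * Q)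
  X-div = Div-cancel 1 p∤2 (Div-resp (sym eq)
    (Div-+ (Div-+ (Div-lin (ι-int 4) (⊝ ι-int 4) (Div-* (Div-P^ 1) (Div-* H₂-div PO-div)) (Div-* (Div-P^ 2) Y-div))
                  (Div-* (Div-P^ 1) CD-div))
           (Div-* (Div-P^ 1) (Div-lin (⊝ 1-int) (ι-int 14) H₂-h₂ H₂+2Q-div))))
    where
    open ≡-Reasoning
    eq : ι 2 * (ι 2 * P * P * X - ι 7 * P * Q) ≡
      ι 4 * (P ^ 1 * (H₂ * (P * O p - 1#))) + - ι 4 * (P ^ 2 * (P * Y - Y′)) + P ^ 1 * (ι 4 * CD - ι 46 * Q)
      + P ^ 1 * (- 1# * (ι 14 * H₂ - ι 4 * h₂) + ι 14 * (H₂ + ι 2 * Q))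
    eq = begin
      ι 2 * (ι 2 * P * P * X - ι 7 * P * Q)
        ≡⟨ solve 3 (λ P X Q → :ι 2 :* (:ι 2 :* P :* P :* X :- :ι 7 :* P :* Q)
             := :ι 4 :* (P :* P :* X) :- :ι 14 :* P :* Q) refl P X Q ⟩
      ι 4 * (P * P * X) - ι 14 * P * Q
        ≡⟨ cong (λ z → ι 4 * z - ι 14 * P * Q) X≡ ⟩
      ι 4 * (P * H₂ * (P * O p) - P * P * (P * Y) + P * CD) - ι 14 * P * Q
        ≡⟨ solve 6 (λ P H PO PY CD Q → :ι 4 :* (P :* H :* PO :- P :* P :* PY :+ P :* CD) :- :ι 14 :* P :* Q
             := :ι 4 :* (P :* H :* PO) :- :ι 4 :* (P :* P :* PY) :+ :ι 4 :* P :* CD :- :ι 14 :* P :* Q)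
             refl P H₂ (P * O p) (P * Y) CD Q ⟩
      ι 4 * (P * H₂ * (P * O p)) - ι 4 * (P * P * (P * Y)) + ι 4 * P * CD - ι 14 * P * Q
        ≡⟨ solve 8 (λ P H PO PY CD Q h Y′ → :ι 4 :* (P :* H :* PO) :- :ι 4 :* (P :* P :* PY) :+ :ι 4 :* P :* CD :- :ι 14 :* P :* Q
             := :ι 4 :* (P :^ 1 :* (H :* (PO :- :1))) :+ :- :ι 4 :* (P :^ 2 :* (PY :- Y′)) :+ P :^ 1 :* (:ι 4 :* CD :- :ι 46 :* Q)
                :+ (:ι 4 :* P :* H :+ :ι 32 :* P :* Q :- :ι 4 :* P :* (P :* Y′))) refl P H₂ (P * O p) (P * Y) CD Q h₂ Y′ ⟩
      E + (ι 4 * P * H₂ + ι 32 * P * Q - ι 4 * P * (P * Y′))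
        ≡⟨ cong (λ z → E + (ι 4 * P * H₂ + ι 32 * P * Q - ι 4 * P * z)) P*Y′ ⟩
      E + (ι 4 * P * H₂ + ι 32 * P * Q - ι 4 * P * (H₂ - h₂ + Q))
        -- What remains is 4P(h₂ + 7Q), rewritten through the two relations between `H₂`, `h₂` and
        -- `Q` that hold modulo p³.
        ≡⟨ cong (_+_ E) (solve 4 (λ P H Q h → :ι 4 :* P :* H :+ :ι 32 :* P :* Q :- :ι 4 :* P :* (H :- h :+ Q)
             := P :^ 1 :* (:- :1 :* (:ι 14 :* H :- :ι 4 :* h) :+ :ι 14 :* (H :+ :ι 2 :* Q))) refl P H₂ Q h₂) ⟩
      E + P ^ 1 * (- 1# * (ι 14 * H₂ - ι 4 * h₂) + ι 14 * (H₂ + ι 2 * Q)) ∎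
      where
      E = ι 4 * (P ^ 1 * (H₂ * (P * O p - 1#))) + - ι 4 * (P ^ 2 * (P * Y - Y′)) + P ^ 1 * (ι 4 * CD - ι 46 * Q)

-- Reduction of the Apéry sum modulo p⁶ and conclusion

module Supercongruence (𝓡 : RationalAlgebra) (m : ℕ) (𝓘 : PIntegral 𝓡 (suc (m ℕ.+ m)))
  (p∤2 : ¬ suc (m ℕ.+ m) ∣ 2) (p∤15 : ¬ suc (m ℕ.+ m) ∣ 15) where
  open Base 𝓡
  open AperySum 𝓡
  open ExactSums 𝓡 using (O; H)
  open Congruences 𝓡 m 𝓘 p∤2 p∤15
  open Divisible 𝓡 p 𝓘

  -- `B j` is the coefficient of P⁴ in `q P j`: it is e₁² + 2e₂ in the elementary symmetric
  -- functions of the 1/i² with i ≤ j, written in power sums.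
  G E B : ℕ → Carrier
  G j = sum j (λ i → u i ²)
  E j = sum j (λ i → u i ⁴)
  B j = ι 2 * G j ² - E j

  G-int : ∀ {j} → j ℕ.≤ l → Integral (G j)
  G-int j≤l = sum-int _ (λ i i<j → u-int (ℕ.<-≤-trans i<j j≤l) ⊗ u-int (ℕ.<-≤-trans i<j j≤l))

  B-int : ∀ {j} → j ℕ.≤ l → Integral (B j)
  B-int j≤l = ι-int 2 ⊗ (G-int j≤l ⊗ G-int j≤l) ⊕ ⊝ sum-int _ (λ i i<j →
    let w = u-int (ℕ.<-≤-trans i<j j≤l) in w ⊗ w ⊗ (w ⊗ w))

  -- `q` involves only even powers of P, so truncation after P⁴ costs P⁶; the bound on `j` keeps
  -- every reciprocal in the remainder integral.
  q-expansion : ∀ j → j ℕ.≤ l → Div 6 (q P j - (1# - ι 2 * P ^ 2 * G j + P ^ 4 * B j))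
  q-expansion zero _ = div 0# 0-int
    (solve 1 (λ P → :1 :- (:1 :- :ι 2 :* P :^ 2 :* :0 :+ P :^ 4 :* (:ι 2 :* (:0 :* :0) :- :0))
         := P :^ 6 :* :0) refl P)
  q-expansion (suc j) j<l with q-expansion j (ℕ.<⇒≤ j<l)
  ... | div c ic e = div
    (- ι 2 * w * B j - ι 2 * w ² * G j + P ^ 2 * w ² * B j + f * c)
    (⊝ ι-int 2 ⊗ iw ⊗ B-int j≤l ⊕ ⊝ (ι-int 2 ⊗ (iw ⊗ iw) ⊗ G-int j≤l) ⊕ P-int ⊗ (P-int ⊗ 1-int) ⊗ (iw ⊗ iw) ⊗ B-int j≤l ⊕ if ⊗ ic)
    (begin
      f * q P j - (1# - ι 2 * P ^ 2 * (G j + w) + P ^ 4 * (ι 2 * (G j + w) ² - (E j + w ²)))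
        ≡⟨ cong (λ z → f * z - (1# - ι 2 * P ^ 2 * (G j + w) + P ^ 4 * (ι 2 * (G j + w) ² - (E j + w ²)))) q≡ ⟩
      f * (1# - ι 2 * P ^ 2 * G j + P ^ 4 * B j + P ^ 6 * c) - (1# - ι 2 * P ^ 2 * (G j + w) + P ^ 4 * (ι 2 * (G j + w) ² - (E j + w ²)))
        ≡⟨ solve 5 (λ P w c G E →
              let f = (:1 :- P :* P :* w) :* (:1 :- P :* P :* w)
                  B = :ι 2 :* (G :* G) :- E in
              f :* (:1 :- :ι 2 :* P :^ 2 :* G :+ P :^ 4 :* B :+ P :^ 6 :* c)
              :- (:1 :- :ι 2 :* P :^ 2 :* (G :+ w) :+ P :^ 4 :* (:ι 2 :* ((G :+ w) :* (G :+ w)) :- (E :+ w :* w)))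
           := P :^ 6 :* (:- :ι 2 :* w :* B :- :ι 2 :* (w :* w) :* G :+ P :^ 2 :* (w :* w) :* B :+ f :* c))
           refl P w c (G j) (E j) ⟩
      P ^ 6 * (- ι 2 * w * B j - ι 2 * w ² * G j + P ^ 2 * w ² * B j + f * c) ∎)
    where
    open ≡-Reasoning
    j≤l = ℕ.<⇒≤ j<l
    w = u j ²
    f = (1# - P * P * w) * (1# - P * P * w)
    iw : Integral w
    iw = u-int j<l ⊗ u-int j<l
    ig : Integral (1# - P * P * w)
    ig = 1-int ⊕ ⊝ (P-int ⊗ P-int ⊗ iw)
    if : Integral f
    if = ig ⊗ ig
    q≡ : q P j ≡ 1# - ι 2 * P ^ 2 * G j + P ^ 4 * B j + P ^ 6 * c
    q≡ = trans (solve 2 (λ a b → a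
         := b :+ (a :- b)) refl _ _) (cong (_+_ (1# - ι 2 * P ^ 2 * G j + P ^ 4 * B j)) e)

  -- Only j = m is critical: there o m = 1/p, which B m ≡ 0 (mod p) compensates.
  oB-int : ∀ j → j ℕ.≤ l → Integral (P * o j) × Integral (o j * B j)
  oB-int j j≤l with ℕ.<-cmp j m
  ... | tri< j<m _ _ = P-int ⊗ o-int j<m , o-int j<m ⊗ B-int j≤l
  ... | tri≈ _ refl _ = subst Integral (sym Pπ) 1-int , Div⇒Integral (Div-π Bm)
    where
    Bm : Div 1 (B m)
    Bm = Div-resp (solve 2 (λ g e → :ι 2 :* (g :* g) :+ :- :1 :* e := :ι 2 :* (g :* g) :- e) refl h₂ h₄)
      (Div-lin (ι-int 2) (⊝ 1-int) (Div-pred (Div-* h₂-div h₂-div)) h₄-div)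
    Div-π : ∀ {z} → Div 1 z → Div 0 (π * z)
    Div-π (div c ic refl) = div c ic (trans (solve 3 (λ π P c → π :* (P :^ 1 :* c)
         := (P :* π) :* c) refl π P c) (cong (_* c) Pπ))
  ... | tri> _ _ m<j with ℕ.m≤n⇒∃[o]m+o≡n m<j
  ... | (d , refl) = P-int ⊗ io , io ⊗ B-int j≤l
    where
    io : Integral (o (suc (m ℕ.+ d)))
    io = o-upper-int (ℕ.+-cancelˡ-≤ m (suc d) m (ℕ.≤-trans (ℕ.≤-reflexive (ℕ.+-suc m d)) j≤l))

  S : Carrier
  S = sum p (λ k → ι ((2 ℕ.* k ℕ.+ 1) ℕ.* apery k))

  S≡ : S ≡ sum p (λ j → P * P * q P j * o j)
  S≡ = trans (apery-sum p) (sum-cong p (λ j _ → cong (_* o j) (W² p j)))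

  S-div : Div 6 (S - P ^ 2 * (O p - ι 2 * P ^ 2 * X))
  S-div = Div-resp eq (Div-sum p (λ { j (s≤s j≤l) → term j j≤l }))
    where
    open ≡-Reasoning
    term : ∀ j → j ℕ.≤ l → Div 6 (1# * (P * P * q P j * o j) + - (P ^ 2) * o j + ι 2 * P ^ 4 * (o j * G j))
    term j j≤l with q-expansion j j≤l | oB-int j j≤l
    -- The factor P² in front leaves p⁸ on the remainder of `q`; even the 1/p hidden in `o j`
    -- reduces this only to p⁷.
    ... | div c ic e | iPo , ioB = div (o j * B j + P * (P * o j * c)) (ioB ⊕ P-int ⊗ (iPo ⊗ ic)) (begin
      1# * (P * P * q P j * o j) + - (P ^ 2) * o j + ι 2 * P ^ 4 * (o j * G j)
        ≡⟨ solve 5 (λ P q o G B → :1 :* (P :* P :* q :* o) :+ :- (P :^ 2) :* o :+ :ι 2 :* P :^ 4 :* (o :* G)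
             := P :^ 2 :* o :* (q :- (:1 :- :ι 2 :* P :^ 2 :* G :+ P :^ 4 :* B)) :+ P :^ 6 :* (o :* B))
             refl P (q P j) (o j) (G j) (B j) ⟩
      P ^ 2 * o j * (q P j - (1# - ι 2 * P ^ 2 * G j + P ^ 4 * B j)) + P ^ 6 * (o j * B j)
        ≡⟨ cong (λ z → P ^ 2 * o j * z + P ^ 6 * (o j * B j)) e ⟩
      P ^ 2 * o j * (P ^ 6 * c) + P ^ 6 * (o j * B j)
        ≡⟨ solve 4 (λ P o c b → P :^ 2 :* o :* (P :^ 6 :* c) :+ P :^ 6 :* b
             := P :^ 6 :* (b :+ P :* (P :* o :* c))) refl P (o j) c (o j * B j) ⟩
      P ^ 6 * (o j * B j + P * (P * o j * c)) ∎)
    eq : sum p (λ j → 1# * (P * P * q P j * o j) + - (P ^ 2) * o j + ι 2 * P ^ 4 * (o j * G j)) ≡ S - P ^ 2 * (O p - ι 2 * P ^ 2 * X)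
    eq = trans (sum-lin₃ p 1# (- (P ^ 2)) (ι 2 * P ^ 4) (λ j → P * P * q P j * o j) o (λ j → o j * G j))
      (trans (cong (λ z → 1# * z + - (P ^ 2) * O p + ι 2 * P ^ 4 * X) (sym S≡))
        (solve 4 (λ P S O X → :1 :* S :+ :- (P :^ 2) :* O :+ :ι 2 :* P :^ 4 :* X
             := S :- P :^ 2 :* (O :- :ι 2 :* P :^ 2 :* X)) refl P S (O p) X))

  -- Doubling avoids the fraction 7/2. The 1/p in `O p` gives the term `P`; `O-div` accounts for 7PQ
  -- and twice `X-div` for 14PQ to be subtracted, which leaves -7PQ.
  doubled : Div 6 (ι 2 * (S - P) + ι 7 * (P ^ 2 * H l))
  doubled = Div-resp eq
    (Div-+ (Div-scale (ι-int 2) S-div)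
           (Div-* (Div-P^ 2) (Div-lin 1-int (⊝ ι-int 2) O-div X-div)))
    where
    open ≡-Reasoning
    eq : ι 2 * (S - P ^ 2 * (O p - ι 2 * P ^ 2 * X)) + P ^ 2 * (1# * (ι 2 * O p - ι 2 * π - ι 7 * P * Q) + - ι 2 * (ι 2 * P * P * X - ι 7 * P * Q))
       ≡ ι 2 * (S - P) + ι 7 * (P ^ 2 * H l)
    eq = begin
      ι 2 * (S - P ^ 2 * (O p - ι 2 * P ^ 2 * X)) + P ^ 2 * (1# * (ι 2 * O p - ι 2 * π - ι 7 * P * Q) + - ι 2 * (ι 2 * P * P * X - ι 7 * P * Q))
        ≡⟨ solve 6 (λ P π S O X Q → :ι 2 :* (S :- P :^ 2 :* (O :- :ι 2 :* P :^ 2 :* X)) :+ P :^ 2 :* (:1 :* (:ι 2 :* O :- :ι 2 :* π :- :ι 7 :* P :* Q) :+ :- :ι 2 :* (:ι 2 :* P :* P :* X :- :ι 7 :* P :* Q))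
             := :ι 2 :* S :- :ι 2 :* P :* (P :* π) :+ :ι 7 :* (P :^ 2 :* (P :* Q))) refl P π S (O p) X Q ⟩
      ι 2 * S - ι 2 * P * (P * π) + ι 7 * (P ^ 2 * (P * Q))
        ≡⟨ cong₂ (λ a b → ι 2 * S - ι 2 * P * a + ι 7 * (P ^ 2 * b)) Pπ (sym H≡PQ) ⟩
      ι 2 * S - ι 2 * P * 1# + ι 7 * (P ^ 2 * H l)
        ≡⟨ solve 3 (λ S P h → :ι 2 :* S :- :ι 2 :* P :* :1 :+ h := :ι 2 :* (S :- P) :+ h) refl S P _ ⟩
      ι 2 * (S - P) + ι 7 * (P ^ 2 * H l) ∎

  supercongruence : Div 6 (S - (P - ι 7 * inv 2 * (ι (p ℕ.^ 2) * H l)))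
  supercongruence = Div-cancel 1 p∤2 (Div-resp (sym (begin
    ι 2 * (S - (P - ι 7 * inv 2 * (ι (p ℕ.^ 2) * H l)))
      ≡⟨ cong (λ z → ι 2 * (S - (P - ι 7 * inv 2 * (z * H l)))) (ι-^ p 2) ⟩
    ι 2 * (S - (P - ι 7 * inv 2 * (P ^ 2 * H l)))
      ≡⟨ solve 4 (λ S P i h → :ι 2 :* (S :- (P :- :ι 7 :* i :* h))
           := :ι 2 :* (S :- P) :+ :ι 7 :* (:ι 2 :* i :* h)) refl S P (inv 2) _ ⟩
    ι 2 * (S - P) + ι 7 * (ι 2 * inv 2 * (P ^ 2 * H l))
      ≡⟨ cong (λ z → ι 2 * (S - P) + ι 7 * (z * (P ^ 2 * H l))) (ι-inv 1) ⟩
    ι 2 * (S - P) + ι 7 * (1# * (P ^ 2 * H l))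
      ≡⟨ cong (λ z → ι 2 * (S - P) + ι 7 * z) (solve 1 (λ h → :1 :* h := h) refl _) ⟩
    ι 2 * (S - P) + ι 7 * (P ^ 2 * H l) ∎)) doubled)
    where open ≡-Reasoning

-- The rational numbers as an instance, and the theorem

open import Defs
open import Data.Nat as ℕ using (ℕ; _≥_; _^_)
open import Data.Nat.Primality using (Prime; euclidsLemma; prime⇒irreducible)
open import Data.Rational as ℚ using (ℚ; _-_; _*_; _/_; ↧_; ↧ₙ_; toℚᵘ)
import Data.Rational.Properties as ℚ
open import Data.Rational.Unnormalised as ℚᵘ using (mkℚᵘ; *≡*; _≃_)
import Data.Rational.Unnormalised.Properties as ℚᵘ
open import Data.Integer using (+_)

toℚᵘ-/ : ∀ i d → toℚᵘ (i / suc d) ≃ mkℚᵘ i d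
toℚᵘ-/ i d = ℚ.toℚᵘ-fromℚᵘ (mkℚᵘ i d)

1+n/1 : ∀ n → ℚ.1ℚ ℚ.+ (+ n / 1) ≡ + suc n / 1
1+n/1 n = ℚ.toℚᵘ-injective (begin
  toℚᵘ (ℚ.1ℚ ℚ.+ (+ n / 1))        ≈⟨ ℚ.toℚᵘ-homo-+ ℚ.1ℚ (+ n / 1) ⟩
  toℚᵘ ℚ.1ℚ ℚᵘ.+ toℚᵘ (+ n / 1)    ≈⟨ ℚᵘ.+-congʳ (toℚᵘ ℚ.1ℚ) (toℚᵘ-/ (+ n) 0) ⟩
  toℚᵘ ℚ.1ℚ ℚᵘ.+ mkℚᵘ (+ n) 0      ≈⟨ *≡* (cong (λ z → (+ 1 ℤ.+ z) ℤ.* + 1) (ℤ.*-identityʳ (+ n))) ⟩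
  mkℚᵘ (+ suc n) 0                 ≈⟨ ℚᵘ.≃-sym (toℚᵘ-/ (+ suc n) 0) ⟩
  toℚᵘ (+ suc n / 1)               ∎)
  where open ℚᵘ.≃-Reasoning

n/1*1/n : ∀ n → (+ suc n / 1) * (+ 1 / suc n) ≡ ℚ.1ℚ
n/1*1/n n = ℚ.toℚᵘ-injective (begin
  toℚᵘ ((+ suc n / 1) * (+ 1 / suc n))            ≈⟨ ℚ.toℚᵘ-homo-* (+ suc n / 1) (+ 1 / suc n) ⟩
  toℚᵘ (+ suc n / 1) ℚᵘ.* toℚᵘ (+ 1 / suc n)      ≈⟨ ℚᵘ.*-cong (toℚᵘ-/ (+ suc n) 0) (toℚᵘ-/ (+ 1) n) ⟩
  mkℚᵘ (+ suc n) 0 ℚᵘ.* mkℚᵘ (+ 1) n              ≈⟨ *≡* (trans (ℤ.*-identityʳ _) (trans (ℤ.*-identityʳ (+ suc n))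
                                                       (sym (trans (ℤ.*-identityˡ _) (cong +_ (ℕ.*-identityˡ (suc n))))))) ⟩
  toℚᵘ ℚ.1ℚ                                       ∎)
  where open ℚᵘ.≃-Reasoning

-- Connects repeated addition of 1, which the abstract ring uses, with the fraction n/1 in the
-- statement.
multiple≡ι : ∀ n → multiple ℚ._+_ ℚ.0ℚ ℚ.1ℚ n ≡ ι n
multiple≡ι zero          = refl
multiple≡ι (suc zero)    = refl
multiple≡ι (suc (suc n)) = trans (cong (ℚ.1ℚ ℚ.+_) (multiple≡ι (suc n))) (1+n/1 (suc n))

reciprocal : ℕ → ℚ
reciprocal zero    = ℚ.0ℚ
reciprocal (suc n) = + 1 / suc n

ℚ-rationalAlgebra : RationalAlgebra
ℚ-rationalAlgebra = record
  { Carrier           = ℚ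
  ; _+_               = ℚ._+_
  ; _*_               = ℚ._*_
  ; -_                = ℚ.-_
  ; 0#                = ℚ.0ℚ
  ; 1#                = ℚ.1ℚ
  ; isCommutativeRing = ℚ.+-*-isCommutativeRing
  ; inv               = reciprocal
  ; ι-inv             = λ n → trans (cong (_* (+ 1 / suc n)) (multiple≡ι (suc n))) (n/1*1/n n)
  }

coprime-∣ : ∀ {m n p} → m ∣ n → Coprime n p → Coprime m p
coprime-∣ m∣n c (d∣m , d∣p) = c (∣-trans d∣m m∣n , d∣p)

coprime-* : ∀ {m n p} → Coprime m p → Coprime n p → Coprime (m ℕ.* n) p
coprime-* {m} {n} cm cn (d∣mn , d∣p) =
  cn (coprime-divisor {o = n} (λ { (e∣d , e∣m) → cm (e∣m , ∣-trans e∣d d∣p) }) d∣mn , d∣p)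

-- Reduction divides a denominator by some gcd `g`, so reduced denominators divide unreduced ones.
-- Closure of the p-integral rationals under sums and products follows.
↧ₙ-*-∣ : ∀ x {n} g → ↧ x ℤ.* g ≡ + n → ↧ₙ x ∣ n
↧ₙ-*-∣ x g eq = divides ℤ.∣ g ∣ (trans (cong ℤ.∣_∣ (sym eq)) (trans (ℤ.abs-* (↧ x) g) (ℕ.*-comm (↧ₙ x) ℤ.∣ g ∣)))

ℚ-pIntegral : ∀ {p} → Prime p → PIntegral ℚ-rationalAlgebra p
ℚ-pIntegral {p} p-prime = record
  { Integral = λ x → Coprime (↧ₙ x) p
  ; _⊕_      = λ {x} {y} cx cy → coprime-∣ (↧ₙ-*-∣ (x ℚ.+ y) _ (ℚ.↧-+ x y)) (coprime-* cx cy)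
  ; _⊗_      = λ {x} {y} cx cy → coprime-∣ (↧ₙ-*-∣ (x ℚ.* y) _ (ℚ.↧-* x y)) (coprime-* cx cy)
  ; ⊝_       = λ {x} cx → subst (λ d → Coprime ℤ.∣ d ∣ p) (sym (ℚ.↧-neg x)) cx
  ; 0-int    = 1-coprime
  ; 1-int    = 1-coprime
  ; inv-int  = λ {n} → inv-coprime n
  }
  where
  1-coprime : Coprime 1 p
  1-coprime (divides-1 , _) = ℕ.m*n≡1⇒n≡1 (_∣_.quotient divides-1) _ (sym (_∣_.equality divides-1))
  inv-coprime : ∀ n → ¬ p ∣ n → Coprime (↧ₙ (reciprocal n)) p
  inv-coprime zero    _   = 1-coprime
  inv-coprime (suc n) p∤n = coprime-∣ (↧ₙ-*-∣ (+ 1 / suc n) _ (ℚ.↧-/ (+ 1) (suc n))) coprime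
    where
    coprime : Coprime (suc n) p
    coprime (d∣n , d∣p) with prime⇒irreducible p-prime d∣p
    ... | inj₁ d≡1  = d≡1
    ... | inj₂ refl = contradiction d∣n p∤n

module _ where
  open Base ℚ-rationalAlgebra using (sum)

  sumℚ≡sum : ∀ n {f g : ℕ → ℚ} → (∀ i → f i ≡ g i) → sumℚ n f ≡ sum n g
  sumℚ≡sum zero    eq = refl
  sumℚ≡sum (suc n) eq = cong₂ ℚ._+_ (sumℚ≡sum n eq) (eq n)

even⊎odd : ∀ n → ∃ (λ m → n ≡ m ℕ.+ m ⊎ n ≡ suc (m ℕ.+ m))
even⊎odd zero = 0 , inj₁ refl
even⊎odd (suc n) with even⊎odd n
... | m , inj₁ refl = m , inj₂ refl
... | m , inj₂ refl = suc m , inj₁ (cong suc (sym (ℕ.+-suc m m)))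

odd-prime : ∀ {p} → Prime p → p ≥ 7 → ∃ (λ m → p ≡ suc (m ℕ.+ m))
odd-prime {p} p-prime p≥7 with even⊎odd p
... | m , inj₂ eq = m , eq
... | m , inj₁ eq with prime⇒irreducible p-prime (divides m (trans eq (trans (cong (m ℕ.+_) (sym (ℕ.+-identityʳ m))) (ℕ.*-comm 2 m))))
...   | inj₂ refl = contradiction p≥7 (ℕ.<⇒≱ (s≤s (s≤s (s≤s z≤n))))

-- The bound `p ≥ 7` rules out both prime factors 3 and 5.
prime∤15 : ∀ {p} → Prime p → p ≥ 7 → ¬ p ∣ 15
prime∤15 p-prime p≥7 p∣15 with euclidsLemma 3 5 p-prime p∣15
... | inj₁ p∣3 = contradiction (ℕ.≤-trans p≥7 (∣⇒≤ p∣3)) (ℕ.<⇒≱ (s≤s (s≤s (s≤s (s≤s z≤n)))))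
... | inj₂ p∣5 = contradiction (ℕ.≤-trans p≥7 (∣⇒≤ p∣5)) (ℕ.<⇒≱ (s≤s (s≤s (s≤s (s≤s (s≤s (s≤s z≤n)))))))

theorem1p1 : (p : ℕ) → Prime p → p ≥ 7 →
    CongQ p
    (sumℚ p (λ k → ι ((2 ℕ.* k ℕ.+ 1) ℕ.* apery k)))
    (ι p - ((+ 7) / 2) * (ι (p ^ 2) * harmonic (p ℕ.∸ 1)))
    (ι (p ^ 6))
theorem1p1 p p-prime p≥7 with odd-prime p-prime p≥7
... | m , refl = quotient , integral , (begin
    sumℚ p (λ k → ι ((2 ℕ.* k ℕ.+ 1) ℕ.* apery k)) - (ι p - ((+ 7) / 2) * (ι (p ^ 2) * harmonic (p ℕ.∸ 1)))
      ≡⟨ cong₂ _-_ (sumℚ≡sum p (λ k → sym (multiple≡ι ((2 ℕ.* k ℕ.+ 1) ℕ.* apery k))))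
           (cong₂ (λ a b → a - ((+ 7) / 2) * b) (sym (multiple≡ι p)) (cong₂ _*_ (sym (multiple≡ι (p ^ 2))) (sumℚ≡sum (m ℕ.+ m) (λ _ → refl)))) ⟩
    -- The closed rationals `ι 7 * inv 2` of the abstract statement and `(+ 7) / 2` agree by
    -- evaluation.
    _ ≡⟨ factors ⟩
    _ ≡⟨ cong (_* quotient) (trans (sym (Base.ι-^ ℚ-rationalAlgebra p 6)) (multiple≡ι (p ^ 6))) ⟩
    ι (p ^ 6) * quotient ∎)
  where
  open ≡-Reasoning
  open Supercongruence ℚ-rationalAlgebra m (ℚ-pIntegral p-prime) (>⇒∤ (ℕ.≤-trans (s≤s (s≤s (s≤s z≤n))) p≥7)) (prime∤15 p-prime p≥7)
  open Divisible.Div supercongruence
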